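{- Let $\alpha\geq 2$, $k\geq 3$ be integers with $k\geq\alpha$, and put $d=k-\alpha$. A $k$-connected graph $G$ of order $\alpha+k$ and independence number $\alpha$ is extremal (that is, its number of edges equals $f(\alpha+k,\alpha,k)$) if and only if $$G\cong\overline{K}_\alpha\vee H,$$ where $H$ is a graph of order $k$ satisfying the one of the following conditions that corresponds to $d$: (i) if $d=0$, then $H\cong\overline{K}_k$; (ii) if $d=1$, then $H$ is a tree; (iii) if $d\geq 2$, then $H$ is $d$-connected and has exactly $\lceil kd/2\rceil$ edges.
   Context: All graphs are finite, simple, and undirected. A graph is $k$-connected if it has more than $k$ vertices and deleting any set of fewer than $k$ vertices leaves a connected graph. The independence number of a graph is the maximum cardinality of a set of pairwise nonadjacent vertices. For integers $n,\alpha,k$ for which the class of $k$-connected graphs of order $n$ and independence number (exactly) $\alpha$ is nonempty, $f(n,\alpha,k)$ denotes the minimum number of edges of a graph in this class; a graph in this class attaining the minimum is called extremal. $\overline{K}_s$ is the edgeless graph of order $s$. The join $G\vee H$ is obtained from disjoint copies of $G$ and $H$ by adding every edge with one endpoint in each copy. -}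

module Defs where

open import Data.Empty using (⊥)
open import Data.Fin using (Fin; splitAt; _<_; _<?_)
open import Data.Fin.Subset using (Subset; _∈_; ∁; ∣_∣; Nonempty) renaming (⊤ to full)
open import Data.List using (List; _∷_; _∷ʳ_; length; filter; allFin; cartesianProduct)
open import Data.List.Relation.Unary.Linked using (Linked)
open import Data.List.Relation.Unary.Unique.Propositional using (Unique)
open import Data.Nat as ℕ using (ℕ; _+_; _≤_)
open import Data.Product using (Σ-syntax; _×_; _,_; proj₁; proj₂)
open import Data.Sum using (_⊎_; inj₁; inj₂)
open import Data.Unit using (⊤; tt)
open import Function.Bundles using (_↔_; _⇔_; Inverse)
open import Level using (0ℓ; Level)
open import Relation.Binary using (Rel; Symmetric; Irreflexive; Decidable)
open import Relation.Binary.Construct.Closure.ReflexiveTransitive using (Star)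
open import Relation.Binary.PropositionalEquality using (_≡_; refl)
open import Relation.Nullary using (¬_; yes; no; _×-dec_)

private variable
  ℓ : Level
  m n : ℕ

IsMinimum : (ℕ → Set ℓ) → ℕ → Set ℓ
IsMinimum P m = P m × (∀ x → P x → m ≤ x)

IsMaximum : (ℕ → Set ℓ) → ℕ → Set ℓ
IsMaximum P m = P m × (∀ x → P x → x ≤ m)

-- Finite simple undirected graphs of order n.  Decidability of adjacency is
-- what makes the number of edges a natural number constructively.
record Graph (n : ℕ) : Set₁ where
  field
    Adj    : Rel (Fin n) 0ℓ
    adj?   : Decidable Adj
    sym    : Symmetric Adj
    irrefl : Irreflexive _≡_ Adj

open Graph public using (Adj; adj?)

-- Each edge is counted once, as the pair (u , v) of its endpoints with u < v.
size : Graph n → ℕ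
size {n} G =
  length (filter (λ p → (proj₁ p <? proj₂ p) ×-dec adj? G (proj₁ p) (proj₂ p))
                 (cartesianProduct (allFin n) (allFin n)))

_≅_ : Graph m → Graph n → Set
_≅_ {m} {n} G H =
  Σ[ φ ∈ Fin m ↔ Fin n ]
    (∀ u v → Adj G u v ⇔ Adj H (Inverse.to φ u) (Inverse.to φ v))

K̄ : (n : ℕ) → Graph n
K̄ n = record
  { Adj    = λ _ _ → ⊥
  ; adj?   = λ _ _ → no λ ()
  ; sym    = λ ()
  ; irrefl = λ _ ()
  }

-- In G ∨ H the first m vertices carry G and the last n carry H.
module Join (G : Graph m) (H : Graph n) where

  JoinAdj : Rel (Fin m ⊎ Fin n) 0ℓ
  JoinAdj (inj₁ u) (inj₁ v) = Adj G u v
  JoinAdj (inj₁ _) (inj₂ _) = ⊤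
  JoinAdj (inj₂ _) (inj₁ _) = ⊤
  JoinAdj (inj₂ u) (inj₂ v) = Adj H u v

  joinAdj? : Decidable JoinAdj
  joinAdj? (inj₁ u) (inj₁ v) = adj? G u v
  joinAdj? (inj₁ _) (inj₂ _) = yes tt
  joinAdj? (inj₂ _) (inj₁ _) = yes tt
  joinAdj? (inj₂ u) (inj₂ v) = adj? H u v

  joinSym : Symmetric JoinAdj
  joinSym {inj₁ _} {inj₁ _} e = Graph.sym G e
  joinSym {inj₁ _} {inj₂ _} _ = tt
  joinSym {inj₂ _} {inj₁ _} _ = tt
  joinSym {inj₂ _} {inj₂ _} e = Graph.sym H e

  joinLoopless : ∀ x → ¬ JoinAdj x x
  joinLoopless (inj₁ _) = Graph.irrefl G refl
  joinLoopless (inj₂ _) = Graph.irrefl H refl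

_∨_ : Graph m → Graph n → Graph (m + n)
_∨_ {m} G H = record
  { Adj    = λ u v → JoinAdj (splitAt m u) (splitAt m v)
  ; adj?   = λ u v → joinAdj? (splitAt m u) (splitAt m v)
  ; sym    = λ {u} {v} → joinSym {splitAt m u} {splitAt m v}
  ; irrefl = λ { {u} refl → joinLoopless (splitAt m u) }
  }
  where open Join G H

-- Connectedness of the subgraph induced by W; the graph with no vertices is
-- not counted as connected.
ConnectedOn : Graph n → Subset n → Set
ConnectedOn G W =
  Nonempty W ×
  (∀ u v → u ∈ W → v ∈ W → Star (λ x y → x ∈ W × y ∈ W × Adj G x y) u v)

Connected : Graph n → Set
Connected G = ConnectedOn G full

KConnected : ℕ → Graph n → Set
KConnected {n} k G =
  k ℕ.< n × (∀ (S : Subset n) → ∣ S ∣ ℕ.< k → ConnectedOn G (∁ S))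

-- The cycle v, v₁, …, vᵣ, v is given by its start v and the list v₁, …, vᵣ.
IsCycle : Graph n → Fin n → List (Fin n) → Set
IsCycle G v vs =
  3 ≤ length (v ∷ vs) × Unique (v ∷ vs) × Linked (Adj G) (v ∷ vs ∷ʳ v)

Acyclic : Graph n → Set
Acyclic G = ∀ v vs → ¬ IsCycle G v vs

Tree : Graph n → Set
Tree G = Connected G × Acyclic G

Independent : Graph n → Subset n → Set
Independent G S = ∀ u v → u ∈ S → v ∈ S → ¬ Adj G u v

IndependenceNumber : Graph n → ℕ → Set
IndependenceNumber {n} G =
  IsMaximum (λ a → Σ[ S ∈ Subset n ] (Independent G S × ∣ S ∣ ≡ a))

InClass : (α k : ℕ) → Graph n → Set
InClass α k G = KConnected k G × IndependenceNumber G α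

-- f(n,α,k) = e.  As f is defined only for nonempty classes, it is given by
-- its graph; the attainment part of IsMinimum entails nonemptiness.
f[_,_,_]≡_ : (n α k e : ℕ) → Set₁
f[ n , α , k ]≡ e =
  IsMinimum (λ x → Σ[ G ∈ Graph n ] (InClass α k G × size G ≡ x)) e

Extremal : (α k : ℕ) → Graph n → Set₁
Extremal {n} α k G = InClass α k G × (f[ n , α , k ]≡ size G)

-- Let S be an independent set of size α in a k-connected graph G of order α + k.
-- Each vertex of S is adjacent to all k vertices outside S, so G is K̄ α ∨ H
-- with H of order k, and deleting S shows that H is d-connected.  Conversely the
-- join of K̄ α with any d-connected H is in the class: all degrees are at least
-- k, and an independent set misses the neighbours of its members.  So G is
-- extremal iff H has the fewest edges among the d-connected graphs of order k.
-- For d = 1 these are the trees.  For d ≥ 2 minimum degree gives the bound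
-- ⌈kd/2⌉, attained by Harary's graphs: unrolled around the cycle, a separation
-- is a periodic sequence in which each of at least two colour changes requires
-- m = ⌊d/2⌋ consecutive deleted vertices; if d = 2m + 1 and only these 2m
-- vertices are deleted, a chord joins the two remaining runs.
module Submission where

open import Data.Nat using (ℕ; zero; suc; _+_; _*_; _∸_; _≤_; _<_; z≤n; s≤s; s≤s⁻¹; NonZero; ⌊_/2⌋; ⌈_/2⌉)
open import Data.Nat.Properties
open import Algebra.Properties.CommutativeMonoid.Sum +-0-commutativeMonoid
  using (sum; sum-cong-≗; ∑-comm; ∑-distrib-+; sum-permute)
open import Data.Bool using (Bool; true; false; if_then_else_)
import Data.Bool.Properties as Bool
open import Data.Empty using (⊥; ⊥-elim)
open import Data.Fin as F using (Fin; zero; suc; toℕ; fromℕ<; _↑ˡ_; _↑ʳ_; splitAt; join)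
import Data.Fin.Properties as F
open import Data.Fin.Properties using (splitAt-↑ˡ; splitAt-↑ʳ; join-splitAt; splitAt-join)
open import Data.Fin.Subset using (Subset; _∈_; _∉_; ∁; ∣_∣; Nonempty; inside; outside)
  renaming (⊤ to full; ⊥ to ∅)
open import Data.Fin.Subset.Properties
  using (_∈?_; nonempty?; Empty-unique; ∣⊥∣≡0; ∣∁p∣≡n∸∣p∣; ∣p∣≤n; ∣p∣≡n⇒p≡⊤;
         x∈∁p⇒x∉p; x∉p⇒x∈∁p; ∈⊤; ∉⊥)
open import Data.List as List
  using (List; []; _∷_; _∷ʳ_; _++_; length; map; filter; allFin; upTo; cartesianProduct; cartesianProductWith)
open import Data.List.Membership.Propositional using () renaming (_∈_ to _∈ˡ_)
open import Data.List.Membership.Propositional.Properties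
  using (∈-filter⁺; ∈-filter⁻; ∈-allFin; ∈-cartesianProduct⁺; ∈-cartesianProductWith⁺;
         ∈-map⁺; ∈-upTo⁺; ∈-++⁺ˡ; ∈-++⁺ʳ)
import Data.List.Membership.DecPropositional as DecMembership
open import Data.List.Properties using (filter-++; length-++; length-map; length-upTo; map-tabulate)
open import Data.List.Relation.Unary.All as All using (All; []; _∷_)
open import Data.List.Relation.Unary.All.Properties using (¬Any⇒All¬; all-filter)
open import Data.List.Relation.Unary.AllPairs using ([]; _∷_)
open import Data.List.Relation.Unary.Any using (here; there)
open import Data.List.Relation.Unary.Linked using (Linked; [-]; _∷_)
open import Data.List.Relation.Unary.Unique.Propositional using (Unique)
import Data.List.Relation.Unary.Unique.Propositional.Properties as Unique
open import Data.Maybe using (Maybe; just; nothing)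
import Data.Maybe.Properties as Maybe
open import Data.Nat.DivMod
open import Data.Nat.Tactic.RingSolver using (solve-∀)
open import Data.Product using (Σ-syntax; ∃; ∃-syntax; _×_; _,_; proj₁; proj₂)
import Data.Product.Properties as Product
open import Data.Sum as Sum using (_⊎_; inj₁; inj₂)
open import Data.Unit using (⊤; tt)
open import Data.Vec as Vec using ([]; _∷_; tabulate)
open import Data.Vec.Properties using ([]=⇒lookup; lookup⇒[]=; lookup∘tabulate)
open import Function using (_∘_; id)
open import Function.Bundles using (_↔_; _⇔_; Inverse; Equivalence; mk⇔; mk↔ₛ′)
open import Function.Construct.Identity using (↔-id)
open import Level using (0ℓ)
open import Relation.Binary using (Decidable; Rel; Symmetric; tri<; tri≈; tri>)
open import Relation.Binary.Construct.Closure.ReflexiveTransitive as Star using (Star; ε; _◅_; _◅◅_; _⋆)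
open import Relation.Binary.PropositionalEquality
  using (_≡_; _≢_; refl; sym; trans; cong; cong₂; subst; subst₂; module ≡-Reasoning)
open import Relation.Nullary using (¬_; Dec; yes; no; does; contradiction; ¬?; _×-dec_; _⊎-dec_)
open import Relation.Nullary.Decidable using (dec-true; dec-false; decidable-stable)
import Relation.Unary as U
open import Defs

-- Connectedness asks for explicit walks, whereas a separation argument goes by contradiction. The
-- components of a finite graph are therefore computed as a labelling of its vertices: being joined
-- by a walk becomes a decidable equality of labels. The same labelling weighs components against
-- edges, as d = 1 requires: minimum degree gives only ⌈k/2⌉ there, which for k > 3 is less than the
-- k - 1 edges of a tree. In the odd Harary graphs the delicate point is the chord between the two
-- remaining runs. When n is odd, a vertex has two nearly opposite positions and only one of them is
-- sure to carry a chord. So a position of the shorter run has to be found for which both candidates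
-- fall into the longer run.

private variable
  m n : ℕ
  A B C P Q : Set

-- Indicator sums, degrees and edge counts

m+m≤n+n⇒m≤n : ∀ {m n} → m + m ≤ n + n → m ≤ n
m+m≤n+n⇒m≤n {m} {n} le with m ≤? n
... | yes m≤n = m≤n
... | no m≰n  = contradiction le (<⇒≱ (+-mono-< (≰⇒> m≰n) (≰⇒> m≰n)))

𝟙 : Dec P → ℕ
𝟙 d = if does d then 1 else 0

𝟙-mono : (P → Q) → (p : Dec P) (q : Dec Q) → 𝟙 p ≤ 𝟙 q
𝟙-mono f (yes p) (yes q) = ≤-refl
𝟙-mono f (yes p) (no ¬q) = ⊥-elim (¬q (f p))
𝟙-mono f (no _)  _       = z≤n

𝟙-cong : (P → Q) → (Q → P) → (p : Dec P) (q : Dec Q) → 𝟙 p ≡ 𝟙 q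
𝟙-cong f g p q = ≤-antisym (𝟙-mono f p q) (𝟙-mono g q p)

𝟙-yes : (p : Dec P) → P → 𝟙 p ≡ 1
𝟙-yes (yes _) _ = refl
𝟙-yes (no ¬p) p = ⊥-elim (¬p p)

𝟙-no : (p : Dec P) → ¬ P → 𝟙 p ≡ 0
𝟙-no (no _)  _  = refl
𝟙-no (yes p) ¬p = ⊥-elim (¬p p)

𝟙-⊎ : (A → P ⊎ Q) → (a : Dec A) (p : Dec P) (q : Dec Q) → 𝟙 a ≤ 𝟙 p + 𝟙 q
𝟙-⊎ f (no _)  _       _       = z≤n
𝟙-⊎ f (yes _) (yes _) _       = s≤s z≤n
𝟙-⊎ f (yes _) (no _)  (yes _) = s≤s z≤n
𝟙-⊎ f (yes a) (no ¬p) (no ¬q) = ⊥-elim (Sum.[ ¬p , ¬q ] (f a))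

sum-mono : {f g : Fin n → ℕ} → (∀ i → f i ≤ g i) → sum f ≤ sum g
sum-mono {zero}  f≤g = z≤n
sum-mono {suc n} f≤g = +-mono-≤ (f≤g zero) (sum-mono (f≤g ∘ suc))

sum-mono-< : {f g : Fin n → ℕ} → (∀ i → f i ≤ g i) → ∀ i → f i < g i → sum f < sum g
sum-mono-< f≤g zero    f<g = +-mono-<-≤ f<g (sum-mono (f≤g ∘ suc))
sum-mono-< f≤g (suc i) f<g = +-mono-≤-< (f≤g zero) (sum-mono-< (f≤g ∘ suc) i f<g)

sum-const : ∀ n {c} → sum {n} (λ _ → c) ≡ n * c
sum-const zero    = refl
sum-const (suc n) = cong (_ +_) (sum-const n)

sum-++ : ∀ m {n} (f : Fin (m + n) → ℕ) →
         sum f ≡ sum (f ∘ (_↑ˡ n)) + sum (f ∘ (m ↑ʳ_))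
sum-++ zero    f = refl
sum-++ (suc m) f = trans (cong (f zero +_) (sum-++ m (f ∘ suc))) (sym (+-assoc (f zero) _ _))

sum-𝟙≟ : (w : Fin n) → sum (λ i → 𝟙 (i F.≟ w)) ≡ 1
sum-𝟙≟ {suc n} zero    = cong suc (trans (sum-const n) (*-zeroʳ n))
sum-𝟙≟ {suc n} (suc w) =
  trans (sum-cong-≗ (λ i → 𝟙-cong F.suc-injective (cong suc) (suc i F.≟ suc w) (i F.≟ w)))
        (sum-𝟙≟ w)

∣p∣≡sum : (p : Subset n) → ∣ p ∣ ≡ sum (λ i → 𝟙 (i ∈? p))
∣p∣≡sum []            = refl
∣p∣≡sum (inside  ∷ p) = cong suc (∣p∣≡sum p)
∣p∣≡sum (outside ∷ p) = ∣p∣≡sum p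

⟦_⟧ : {P : Fin n → Set} → U.Decidable P → Subset n
⟦ P? ⟧ = tabulate (does ∘ P?)

module _ {P : Fin n → Set} (P? : U.Decidable P) where

  ∈⟦⟧⁺ : ∀ {x} → P x → x ∈ ⟦ P? ⟧
  ∈⟦⟧⁺ {x} px = lookup⇒[]= x _ (trans (lookup∘tabulate _ x) (does-yes (P? x)))
    where
    does-yes : (d : Dec (P x)) → does d ≡ true
    does-yes (yes _) = refl
    does-yes (no ¬p) = ⊥-elim (¬p px)

  ∈⟦⟧⁻ : ∀ {x} → x ∈ ⟦ P? ⟧ → P x
  ∈⟦⟧⁻ {x} x∈ with P? x | trans (sym (lookup∘tabulate (does ∘ P?) x)) ([]=⇒lookup x∈)
  ... | yes px | _ = px
  ... | no _   | ()

  ∣⟦⟧∣≡sum : ∣ ⟦ P? ⟧ ∣ ≡ sum (𝟙 ∘ P?)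
  ∣⟦⟧∣≡sum = trans (∣p∣≡sum ⟦ P? ⟧) (sum-cong-≗ (λ i → 𝟙-cong ∈⟦⟧⁻ ∈⟦⟧⁺ (i ∈? ⟦ P? ⟧) (P? i)))

∃-∉ : (p : Subset n) → ∣ p ∣ < n → ∃ (_∉ p)
∃-∉ {n} p p<n with nonempty? (∁ p)
... | yes (x , x∈) = x , x∈∁p⇒x∉p x∈
... | no empty     = contradiction (trans (cong ∣_∣ (sym (Empty-unique empty))) (∣∁p∣≡n∸∣p∣ p))
                       (λ eq → m>n⇒m∸n≢0 p<n (trans (sym eq) (∣⊥∣≡0 n)))

degree : Graph n → Fin n → ℕ
degree G u = sum (λ v → 𝟙 (adj? G u v))

-- `size` counts pairs with u < v, an orientation that isomorphisms do not respect. The degree sum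
-- runs over all ordered pairs, so it reindexes along a permutation and splits along a join; edge
-- counts are compared through it.
degreeSum : Graph n → ℕ
degreeSum G = sum (degree G)

module _ {P : A → Set} (P? : U.Decidable P) where

  length-filter-tabulate : (f : Fin n → A) →
    length (filter P? (List.tabulate f)) ≡ sum (𝟙 ∘ P? ∘ f)
  length-filter-tabulate {zero}  f = refl
  length-filter-tabulate {suc n} f with P? (f zero)
  ... | yes _ = cong suc (length-filter-tabulate (f ∘ suc))
  ... | no  _ = length-filter-tabulate (f ∘ suc)

length-filter-product : {B : Set} {P : A × B → Set} (P? : U.Decidable P)
  (f : Fin m → A) (g : Fin n → B) →
  length (filter P? (cartesianProduct (List.tabulate f) (List.tabulate g)))
    ≡ sum (λ i → sum (λ j → 𝟙 (P? (f i , g j))))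
length-filter-product {m = zero}  P? f g = refl
length-filter-product {m = suc m} P? f g = begin
  length (filter P? (List.map (f zero ,_) ys List.++ zs))
    ≡⟨ cong length (filter-++ P? (List.map (f zero ,_) ys) zs) ⟩
  length (filter P? (List.map (f zero ,_) ys) List.++ filter P? zs)
    ≡⟨ length-++ (filter P? (List.map (f zero ,_) ys)) ⟩
  length (filter P? (List.map (f zero ,_) ys)) + length (filter P? zs)
    ≡⟨ cong₂ _+_ (cong (length ∘ filter P?) (map-tabulate g (f zero ,_)))
                 (length-filter-product P? (f ∘ suc) g) ⟩
  length (filter P? (List.tabulate ((f zero ,_) ∘ g))) + _
    ≡⟨ cong (_+ _) (length-filter-tabulate P? ((f zero ,_) ∘ g)) ⟩
  _ ∎
  where
  open ≡-Reasoning
  ys = List.tabulate g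
  zs = cartesianProduct (List.tabulate (f ∘ suc)) ys

edge? : (G : Graph n) → U.Decidable (λ (p : Fin n × Fin n) → proj₁ p F.< proj₂ p × Adj G (proj₁ p) (proj₂ p))
edge? G p = (proj₁ p F.<? proj₂ p) ×-dec adj? G (proj₁ p) (proj₂ p)

-- Handshake: of (u , v) and (v , u) exactly one is increasing when uv is an edge, and exchanging
-- the order of summation identifies the two halves.
degreeSum≡2size : (G : Graph n) → degreeSum G ≡ size G + size G
degreeSum≡2size {n} G = begin
  sum (λ u → sum (λ v → 𝟙 (adj? G u v)))
    ≡⟨ sum-cong-≗ (λ u → sum-cong-≗ (orient u)) ⟩
  sum (λ u → sum (λ v → e u v + e v u))
    ≡⟨ sum-cong-≗ (λ u → ∑-distrib-+ (e u) (λ v → e v u)) ⟩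
  sum (λ u → sum (λ v → e u v) + sum (λ v → e v u))
    ≡⟨ ∑-distrib-+ (λ u → sum (e u)) (λ u → sum (λ v → e v u)) ⟩
  sum (λ u → sum (e u)) + sum (λ u → sum (λ v → e v u))
    ≡⟨ cong (sum (λ u → sum (e u)) +_) (∑-comm (λ u v → e v u)) ⟩
  sum (λ u → sum (e u)) + sum (λ u → sum (e u))
    ≡⟨ sym (cong₂ _+_ size≡ size≡) ⟩
  size G + size G ∎
  where
  open ≡-Reasoning
  e : Fin n → Fin n → ℕ
  e u v = 𝟙 (edge? G (u , v))
  size≡ : size G ≡ sum (λ u → sum (e u))
  size≡ = length-filter-product (edge? G) id id
  orient : ∀ u v → 𝟙 (adj? G u v) ≡ e u v + e v u
  orient u v with F.<-cmp u v
  ... | tri< u<v _ v≮u = trans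
    (𝟙-cong (u<v ,_) proj₂ (adj? G u v) (edge? G (u , v)))
    (sym (trans (cong (e u v +_) (𝟙-no (edge? G (v , u)) (v≮u ∘ proj₁))) (+-identityʳ _)))
  ... | tri> u≮v _ v<u = trans
    (𝟙-cong ((v<u ,_) ∘ Graph.sym G) (Graph.sym G ∘ proj₂) (adj? G u v) (edge? G (v , u)))
    (sym (cong (_+ e v u) (𝟙-no (edge? G (u , v)) (u≮v ∘ proj₁))))
  ... | tri≈ u≮v u≡v v≮u = trans (𝟙-no (adj? G u v) (Graph.irrefl G u≡v))
    (sym (cong₂ _+_ (𝟙-no (edge? G (u , v)) (u≮v ∘ proj₁)) (𝟙-no (edge? G (v , u)) (v≮u ∘ proj₁))))

degreeSum-mono⇒size-mono : (G : Graph m) (H : Graph n) → degreeSum G ≤ degreeSum H → size G ≤ size H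
degreeSum-mono⇒size-mono G H le =
  m+m≤n+n⇒m≤n (subst₂ _≤_ (degreeSum≡2size G) (degreeSum≡2size H) le)

size-mono⇒degreeSum-mono : (G : Graph m) (H : Graph n) → size G ≤ size H → degreeSum G ≤ degreeSum H
size-mono⇒degreeSum-mono G H le rewrite degreeSum≡2size G | degreeSum≡2size H = +-mono-≤ le le

degreeSum-≅ : (G : Graph m) (H : Graph n) → G ≅ H → degreeSum G ≡ degreeSum H
degreeSum-≅ G H (φ , φ⇔) = sym (trans (sum-permute (degree H) φ) (sum-cong-≗ λ u →
  trans (sum-permute (λ v → 𝟙 (adj? H (Inverse.to φ u) v)) φ) (sum-cong-≗ λ v →
  𝟙-cong (Equivalence.from (φ⇔ u v)) (Equivalence.to (φ⇔ u v)) (adj? H _ _) (adj? G u v))))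

-- The first summand depends on α and k alone, so minimising the edges of the join amounts to
-- minimising those of H.
degreeSum-∨ : ∀ α {k} (H : Graph k) → degreeSum (K̄ α ∨ H) ≡ (α * k + k * α) + degreeSum H
degreeSum-∨ α {k} H = begin
  degreeSum J
    ≡⟨ sum-++ α (degree J) ⟩
  sum (λ i → degree J (i ↑ˡ k)) + sum (λ j → degree J (α ↑ʳ j))
    ≡⟨ cong₂ _+_ (trans (sum-cong-≗ degˡ) (sum-const α))
         (trans (sum-cong-≗ degʳ) (trans (∑-distrib-+ (λ _ → α) (degree H)) (cong (_+ degreeSum H) (sum-const k)))) ⟩
  α * k + (k * α + degreeSum H)
    ≡⟨ sym (+-assoc (α * k) _ _) ⟩
  (α * k + k * α) + degreeSum H ∎
  where
  open ≡-Reasoning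
  J = K̄ α ∨ H
  all-ones : ∀ n → sum {n} (λ _ → 1) ≡ n
  all-ones n = trans (sum-const n) (*-identityʳ n)
  degˡ : ∀ i → degree J (i ↑ˡ k) ≡ k
  degˡ i = trans (sum-++ α _) (cong₂ _+_
      (trans (sum-cong-≗ 0ˡ) (trans (sum-const α) (*-zeroʳ α)))
      (trans (sum-cong-≗ 1ʳ) (all-ones k)))
    where
    0ˡ : ∀ i′ → 𝟙 (adj? J (i ↑ˡ k) (i′ ↑ˡ k)) ≡ 0
    0ˡ i′ rewrite splitAt-↑ˡ α i k | splitAt-↑ˡ α i′ k = refl
    1ʳ : ∀ j → 𝟙 (adj? J (i ↑ˡ k) (α ↑ʳ j)) ≡ 1
    1ʳ j rewrite splitAt-↑ˡ α i k | splitAt-↑ʳ α k j = refl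
  degʳ : ∀ j → degree J (α ↑ʳ j) ≡ α + degree H j
  degʳ j = trans (sum-++ α _) (cong₂ _+_ (trans (sum-cong-≗ 1ˡ) (all-ones α)) (sum-cong-≗ adjʳ))
    where
    1ˡ : ∀ i → 𝟙 (adj? J (α ↑ʳ j) (i ↑ˡ k)) ≡ 1
    1ˡ i rewrite splitAt-↑ʳ α k j | splitAt-↑ˡ α i k = refl
    adjʳ : ∀ j′ → 𝟙 (adj? J (α ↑ʳ j) (α ↑ʳ j′)) ≡ 𝟙 (adj? H j j′)
    adjʳ j′ rewrite splitAt-↑ʳ α k j | splitAt-↑ʳ α k j′ = refl

-- Component labellings and spanning forests

Joined : List (Fin n × Fin n) → Rel (Fin n) 0ℓ
Joined E x y = (x , y) ∈ˡ E ⊎ (y , x) ∈ˡ E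

-- Kruskal's condition, read from the end of the list: every edge joins two vertices that the edges
-- after it leave unconnected.
data Forest {n} : List (Fin n × Fin n) → Set where
  []  : Forest []
  _∷_ : ∀ {u v E} → ¬ Star (Joined E) u v → Forest E → Forest ((u , v) ∷ E)

Joined-sym : (E : List (Fin n × Fin n)) → Symmetric (Joined E)
Joined-sym E = Sum.swap

Joined-weaken : ∀ {e} (E : List (Fin n × Fin n)) {x y} → Joined E x y → Joined (e ∷ E) x y
Joined-weaken E = Sum.map there there

-- Adding an edge either merges two components, which removes one root, or
-- closes a cycle; hence the inequality `spanning' and its equality case.
record Labelling {n} (E : List (Fin n × Fin n)) : Set where
  field
    label      : Fin n → Fin n
    idempotent : ∀ x → label (label x) ≡ label x
    sound      : ∀ {x y} → label x ≡ label y → Star (Joined E) x y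
    complete   : ∀ {x y} → (x , y) ∈ˡ E → label x ≡ label y
  roots : ℕ
  roots = sum (λ x → 𝟙 (label x F.≟ x))
  field
    spanning : n ≤ roots + length E
    forest   : Forest E → n ≡ roots + length E

module _ {n} {E : List (Fin n × Fin n)} (L : Labelling E) {u v : Fin n}
         (ℓu≢ℓv : Labelling.label L u ≢ Labelling.label L v) where

  open Labelling L

  private
    merged : Fin n → Fin n
    merged x = if does (label x F.≟ label v) then label u else label x

    merged-≡ : ∀ {x} → label x ≡ label v → merged x ≡ label u
    merged-≡ {x} eq rewrite dec-true (label x F.≟ label v) eq = refl

    merged-≢ : ∀ {x} → label x ≢ label v → merged x ≡ label x
    merged-≢ {x} neq rewrite dec-false (label x F.≟ label v) neq = refl

    merged-cong : ∀ {x y} → label x ≡ label y → merged x ≡ merged y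
    merged-cong eq rewrite eq = refl

    merged-u : merged u ≡ label u
    merged-u = merged-≢ ℓu≢ℓv

    E′ = (u , v) ∷ E

    sound′ : ∀ {x y} → label x ≡ label y → Star (Joined E′) x y
    sound′ = Star.map (Joined-weaken E) ∘ sound

    toLabel : ∀ x → Star (Joined E′) x (label x)
    toLabel x = sound′ (sym (idempotent x))

    toMerged : ∀ x → Star (Joined E′) x (merged x)
    toMerged x with label x F.≟ label v
    ... | yes eq = sound′ eq ◅◅ (inj₂ (here refl) ◅ toLabel u)
    ... | no  _  = toLabel x

    merged-idempotent : ∀ x → merged (merged x) ≡ merged x
    merged-idempotent x with label x F.≟ label v
    ... | yes _ = trans (merged-cong (idempotent u)) merged-u
    ... | no neq = trans (merged-cong (idempotent x)) (merged-≢ neq)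

    complete′ : ∀ {x y} → (x , y) ∈ˡ E′ → merged x ≡ merged y
    complete′ (here refl) = trans merged-u (sym (merged-≡ refl))
    complete′ (there e)   = merged-cong (complete e)

    -- The merger costs exactly the root `label v`. Every other root keeps its label, and no root is
    -- gained because `label u` was one already.
    oldRoot : ∀ x → 𝟙 (label x F.≟ x) ≡ 𝟙 (merged x F.≟ x) + 𝟙 (x F.≟ label v)
    oldRoot x with x F.≟ label v
    ... | yes refl = trans (𝟙-yes (_ F.≟ _) (idempotent v))
            (cong (_+ 1) (sym (𝟙-no (merged x F.≟ x) λ eq → ℓu≢ℓv (trans (sym (merged-≡ (idempotent v))) eq))))
    ... | no x≢ = trans (𝟙-cong to from (label x F.≟ x) (merged x F.≟ x)) (sym (+-identityʳ _))
      where
      to : label x ≡ x → merged x ≡ x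
      to eq = trans (merged-≢ (λ eq′ → x≢ (trans (sym eq) eq′))) eq
      from : merged x ≡ x → label x ≡ x
      from eq with label x F.≟ label v
      ... | yes eq′ = ⊥-elim (ℓu≢ℓv (trans (sym (idempotent u)) (trans (cong label eq) eq′)))
      ... | no _    = eq

    roots≡ : roots ≡ sum (λ x → 𝟙 (merged x F.≟ x)) + 1
    roots≡ = trans (sum-cong-≗ oldRoot) (trans (∑-distrib-+ (λ x → 𝟙 (merged x F.≟ x)) _)
      (cong (sum (λ x → 𝟙 (merged x F.≟ x)) +_) (sum-𝟙≟ (label v))))

    count≡ : roots + length E ≡ sum (λ x → 𝟙 (merged x F.≟ x)) + length E′
    count≡ = trans (cong (_+ length E) roots≡) (+-assoc (sum (λ x → 𝟙 (merged x F.≟ x))) 1 (length E))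

  merge : Labelling E′
  merge = record
    { label      = merged
    ; idempotent = merged-idempotent
    ; sound      = λ {x} {y} eq → toMerged x ◅◅ subst (λ z → Star (Joined E′) z y) (sym eq)
                     (Star.reverse (Joined-sym E′) (toMerged y))
    ; complete   = complete′
    ; spanning   = ≤-trans spanning (≤-reflexive count≡)
    ; forest     = λ { (_ ∷ f) → trans (forest f) count≡ }
    }

labelling : (E : List (Fin n × Fin n)) → Labelling E
labelling {n} [] = record
  { label      = id
  ; idempotent = λ _ → refl
  ; sound      = λ { refl → ε }
  ; complete   = λ ()
  ; spanning   = ≤-reflexive n≡
  ; forest     = λ _ → n≡
  }
  where
  n≡ : n ≡ sum {n} (λ x → 𝟙 (x F.≟ x)) + 0
  n≡ = sym (trans (+-identityʳ _) (trans (sum-cong-≗ {n} (λ x → 𝟙-yes (x F.≟ x) refl))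
         (trans (sum-const n) (*-identityʳ n))))
labelling ((u , v) ∷ E) with labelling E
... | L with Labelling.label L u F.≟ Labelling.label L v
...   | no neq = merge L neq
...   | yes eq = record
  { label      = label
  ; idempotent = idempotent
  ; sound      = Star.map (Joined-weaken E) ∘ sound
  ; complete   = λ { (here refl) → eq ; (there e) → complete e }
  ; spanning   = ≤-trans spanning (+-monoʳ-≤ roots (n≤1+n _))
  ; forest     = λ { (¬uv ∷ _) → ⊥-elim (¬uv (sound eq)) }
  }
  where open Labelling L

components : {R : Rel (Fin n) 0ℓ} → Decidable R → Symmetric R →
  Σ[ c ∈ (Fin n → Fin n) ] ((∀ {x y} → R x y → c x ≡ c y) × (∀ {x y} → c x ≡ c y → Star R x y))
components {n} {R} R? R-sym = label , complete ∘ R⇒∈ , Star.map Sum.[ ∈⇒R , R-sym ∘ ∈⇒R ] ∘ sound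
  where
  pairs E : List (Fin n × Fin n)
  pairs = cartesianProduct (allFin n) (allFin n)
  E = filter (λ p → R? (proj₁ p) (proj₂ p)) pairs
  open Labelling (labelling E)
  R⇒∈ : ∀ {x y} → R x y → (x , y) ∈ˡ E
  R⇒∈ {x} {y} = ∈-filter⁺ (λ p → R? (proj₁ p) (proj₂ p)) (∈-cartesianProduct⁺ (∈-allFin x) (∈-allFin y))
  ∈⇒R : ∀ {x y} → (x , y) ∈ˡ E → R x y
  ∈⇒R = proj₂ ∘ ∈-filter⁻ (λ p → R? (proj₁ p) (proj₂ p)) {xs = pairs}

-- Walks, cycles and trees

private variable
  R T : Rel (Fin n) 0ℓ

-- The list omits the start, as in `IsCycle`, so that a walk can be closed to a cycle and tested for
-- repeated vertices.
data Walk {n} (R : Rel (Fin n) 0ℓ) : Fin n → List (Fin n) → Fin n → Set where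
  []  : ∀ {x} → Walk R x [] x
  _∷_ : ∀ {x y z vs} → R x y → Walk R y vs z → Walk R x (y ∷ vs) z

walk⇒linked : ∀ {x y w vs} → Walk R x vs y → R y w → Linked R (x ∷ vs ∷ʳ w)
walk⇒linked []       r = r ∷ [-]
walk⇒linked (s ∷ ss) r = s ∷ walk⇒linked ss r

linked⇒walk : ∀ {x w} vs → Linked R (x ∷ vs ∷ʳ w) → ∃[ y ] Walk R x vs y × R y w
linked⇒walk []       (r ∷ [-]) = _ , [] , r
linked⇒walk (_ ∷ vs) (s ∷ ss) with linked⇒walk vs ss
... | y , walk , r = y , s ∷ walk , r

walk-map : (∀ {x y} → R x y → T x y) → ∀ {x vs y} → Walk R x vs y → Walk T x vs y
walk-map f []       = []
walk-map f (s ∷ ss) = f s ∷ walk-map f ss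

walk⇒star : ∀ {x vs y} → Walk R x vs y → Star R x y
walk⇒star []       = ε
walk⇒star (s ∷ ss) = s ◅ walk⇒star ss

SimplePath : Rel (Fin n) 0ℓ → Rel (Fin n) 0ℓ
SimplePath R x y = ∃[ vs ] Walk R x vs y × Unique (x ∷ vs)

-- Loop erasure: when x already occurs on the path, the part before that occurrence is dropped.
simplePath-from : ∀ {w x vs y} → Walk R w vs y → Unique (w ∷ vs) → x ∈ˡ w ∷ vs → SimplePath R x y
simplePath-from ss       uniq       (here refl) = _ , ss , uniq
simplePath-from (_ ∷ ss) (_ ∷ uniq) (there x∈)  = simplePath-from ss uniq x∈

simplePath : ∀ {x y} → Star R x y → SimplePath R x y
simplePath ε = [] , [] , [] ∷ []
simplePath {x = x} (_◅_ {j = z} s ss) with simplePath ss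
... | vs , walk , uniq with DecMembership._∈?_ F._≟_ x (z ∷ vs)
...   | yes x∈ = simplePath-from walk uniq x∈
...   | no  x∉ = z ∷ vs , s ∷ walk , ¬Any⇒All¬ _ x∉ ∷ uniq

edges : Graph n → List (Fin n × Fin n)
edges {n} G = filter (edge? G) (cartesianProduct (allFin n) (allFin n))

edges-sound : (G : Graph n) → All (λ p → proj₁ p F.< proj₂ p × Adj G (proj₁ p) (proj₂ p)) (edges G)
edges-sound {n} G = all-filter (edge? G) (cartesianProduct (allFin n) (allFin n))

edges-unique : (G : Graph n) → Unique (edges G)
edges-unique {n} G = Unique.filter⁺ (edge? G) (Unique.cartesianProduct⁺ (Unique.allFin⁺ n) (Unique.allFin⁺ n))

edges-complete : (G : Graph n) → ∀ {u v} → Adj G u v → Joined (edges G) u v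
edges-complete {n} G {u} {v} uv with F.<-cmp u v
... | tri< u<v _ _ = inj₁ (∈-filter⁺ (edge? G) (∈-cartesianProduct⁺ (∈-allFin u) (∈-allFin v)) (u<v , uv))
... | tri≈ _ u≡v _ = ⊥-elim (Graph.irrefl G u≡v uv)
... | tri> _ _ v<u = inj₂ (∈-filter⁺ (edge? G) (∈-cartesianProduct⁺ (∈-allFin v) (∈-allFin u)) (v<u , Graph.sym G uv))

-- A simple path from u to v along the later edges would be closed to a cycle by uv. It has at least
-- two steps: a single step would repeat the edge (u , v), against uniqueness, or be (v , u),
-- against the orientation u < v.
acyclic⇒forest : (G : Graph n) → Acyclic G → (E : List (Fin n × Fin n)) →
  All (λ p → proj₁ p F.< proj₂ p × Adj G (proj₁ p) (proj₂ p)) E → Unique E → Forest E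
acyclic⇒forest G acyclic [] _ _ = []
acyclic⇒forest G acyclic ((u , v) ∷ E) ((u<v , uv) ∷ sound) (uv∉ ∷ uniq) =
  ¬uv ∘ simplePath ∷ acyclic⇒forest G acyclic E sound uniq
  where
  joined⇒adj : ∀ {x y} → Joined E x y → Adj G x y
  joined⇒adj (inj₁ e) = proj₂ (All.lookup sound e)
  joined⇒adj (inj₂ e) = Graph.sym G (proj₂ (All.lookup sound e))
  ¬uv : ¬ SimplePath (Joined E) u v
  ¬uv (_ , [] , _)            = F.<-irrefl refl u<v
  ¬uv (_ , inj₁ e ∷ [] , _)   = All.lookup uv∉ e refl
  ¬uv (_ , inj₂ e ∷ [] , _)   = F.<-asym u<v (proj₁ (All.lookup sound e))
  ¬uv (_ , walk@(_ ∷ _ ∷ _) , uniq′) = acyclic u _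
    (s≤s (s≤s (s≤s z≤n)) , uniq′ , walk⇒linked (walk-map joined⇒adj walk) (Graph.sym G uv))

connected-path : (G : Graph n) → Connected G → ∀ x y → Star (Adj G) x y
connected-path G (_ , path) x y = Star.map (proj₂ ∘ proj₂) (path x y ∈⊤ ∈⊤)

connected⁺ : (G : Graph n) → Fin n → (∀ x y → Star (Adj G) x y) → Connected G
connected⁺ G v path = (v , ∈⊤) , λ x y _ _ → Star.map (λ r → ∈⊤ , ∈⊤ , r) (path x y)

module _ (G : Graph n) (conn : Connected G) where

  open Labelling (labelling (edges G))

  private
    w = label (proj₁ (proj₁ conn))

    label-star : ∀ {x y} → Star (Adj G) x y → label x ≡ label y
    label-star ε        = refl
    label-star (r ◅ rs) = trans (Sum.[ complete , sym ∘ complete ] (edges-complete G r)) (label-star rs)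

    label≡w : ∀ x → label x ≡ w
    label≡w x = label-star (connected-path G conn x _)

    -- All labels equal `w`, so being a root means being `w`. This turns `spanning` and `forest`
    -- into the edge counts below.
    roots≡1 : roots ≡ 1
    roots≡1 = trans (sum-cong-≗ λ x → 𝟙-cong (λ eq → trans (sym eq) (label≡w x))
                                              (λ eq → trans (label≡w x) (sym eq)) (label x F.≟ x) (x F.≟ w))
                    (sum-𝟙≟ w)

  connected⇒n≤1+size : n ≤ suc (size G)
  connected⇒n≤1+size = subst (λ r → n ≤ r + size G) roots≡1 spanning

  tree⇒n≡1+size : Acyclic G → n ≡ suc (size G)
  tree⇒n≡1+size acyclic = subst (λ r → n ≡ r + size G) roots≡1
    (forest (acyclic⇒forest G acyclic (edges G) (edges-sound G) (edges-unique G)))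

-- Deleting an edge of a cycle

SameEdge : (a b x y : Fin n) → Set
SameEdge a b x y = (x ≡ a × y ≡ b) ⊎ (x ≡ b × y ≡ a)

sameEdge? : (a b x y : Fin n) → Dec (SameEdge a b x y)
sameEdge? a b x y = ((x F.≟ a) ×-dec (y F.≟ b)) ⊎-dec ((x F.≟ b) ×-dec (y F.≟ a))

delete : Graph n → Fin n → Fin n → Graph n
delete G a b = record
  { Adj    = λ x y → Adj G x y × ¬ SameEdge a b x y
  ; adj?   = λ x y → adj? G x y ×-dec ¬? (sameEdge? a b x y)
  ; sym    = λ (xy , neq) → Graph.sym G xy , neq ∘ Sum.[ (λ (p , q) → inj₂ (q , p)) , (λ (p , q) → inj₁ (q , p)) ]
  ; irrefl = λ eq (xy , _) → Graph.irrefl G eq xy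
  }

degreeSum-delete : (G : Graph n) → ∀ {a b} → Adj G a b → degreeSum (delete G a b) < degreeSum G
degreeSum-delete G {a} {b} ab = sum-mono-<
  (λ x → sum-mono (λ y → 𝟙-mono proj₁ (adj? (delete G a b) x y) (adj? G x y))) a
  (sum-mono-< (λ y → 𝟙-mono proj₁ (adj? (delete G a b) a y) (adj? G a y)) b
    (≤-reflexive (trans (cong suc (𝟙-no (adj? (delete G a b) a b) (λ r → proj₂ r (inj₁ (refl , refl)))))
                        (sym (𝟙-yes (adj? G a b) ab)))))

connected-delete : (G : Graph n) → Connected G → ∀ {a b} → Star (Adj (delete G a b)) a b → Connected (delete G a b)
connected-delete G conn {a} {b} detour =
  connected⁺ (delete G a b) (proj₁ (proj₁ conn)) (λ x y → (reroute ⋆) (connected-path G conn x y))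
  where
  reroute : ∀ {x y} → Adj G x y → Star (Adj (delete G a b)) x y
  reroute {x} {y} xy with sameEdge? a b x y
  ... | yes (inj₁ (refl , refl)) = detour
  ... | yes (inj₂ (refl , refl)) = Star.reverse (Graph.sym (delete G a b)) detour
  ... | no neq                   = (xy , neq) ◅ ε

walk-end∈ : ∀ {x z vs y} → Walk R x (z ∷ vs) y → y ∈ˡ z ∷ vs
walk-end∈ (_ ∷ [])           = here refl
walk-end∈ (_ ∷ walk@(_ ∷ _)) = there (walk-end∈ walk)

-- The edge to delete is the closing one, between v and the last vertex y. The rest of the cycle
-- avoids it: its first step leads to z, which differs from y because a cycle has at least three
-- vertices, and later steps never meet v.
cycle⇒detour : (G : Graph n) → ∀ {v vs} → IsCycle G v vs →
  ∃[ y ] Adj G v y × Star (Adj (delete G v y)) v y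
cycle⇒detour G {v} {z ∷ z′ ∷ vs} (_ , v∉ ∷ uniq@(z∉ ∷ _) , linked) with linked⇒walk (z ∷ z′ ∷ vs) linked
... | y , step ∷ walk , yv = y , Graph.sym G yv , (step , first) ◅ walk⇒star (avoid walk v∉)
  where
  end∈ : y ∈ˡ z′ ∷ vs
  end∈ = walk-end∈ walk
  first : ¬ SameEdge v y v z
  first (inj₁ (_ , z≡y)) = All.lookup z∉ end∈ z≡y
  first (inj₂ (v≡y , _)) = All.lookup v∉ (there end∈) v≡y
  avoid : ∀ {x us w} → Walk (Adj G) x us w → All (v ≢_) (x ∷ us) → Walk (Adj (delete G v y)) x us w
  avoid []       _                  = []
  avoid (s ∷ ss) (v≢x ∷ v≢@(v≢x′ ∷ _)) =
    (s , Sum.[ v≢x ∘ sym ∘ proj₁ , v≢x′ ∘ sym ∘ proj₂ ]) ∷ avoid ss v≢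
cycle⇒detour G {v} {[]}     (s≤s () , _)
cycle⇒detour G {v} {_ ∷ []} (s≤s (s≤s ()) , _)

minimal-connected⇒acyclic : (G : Graph n) → Connected G →
  ((G′ : Graph n) → Connected G′ → degreeSum G ≤ degreeSum G′) → Acyclic G
minimal-connected⇒acyclic G conn minimal v vs cycle with cycle⇒detour G cycle
... | y , vy , detour = <⇒≱ (degreeSum-delete G vy) (minimal (delete G v y) (connected-delete G conn detour))

-- Connectivity and independence

Within : Graph n → Subset n → Rel (Fin n) 0ℓ
Within G W x y = x ∈ W × y ∈ W × Adj G x y

within? : (G : Graph n) (W : Subset n) → Decidable (Within G W)
within? G W x y = (x ∈? W) ×-dec (y ∈? W) ×-dec adj? G x y

within-sym : (G : Graph n) (W : Subset n) → Symmetric (Within G W)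
within-sym G W (x∈ , y∈ , xy) = y∈ , x∈ , Graph.sym G xy

-- The premise is applied to the labelling given by `components`, where equal labels produce a walk.
-- Since equality of labels is decidable, the premise may be proved by contradiction.
connectedOn⁺ : (G : Graph n) (W : Subset n) → Nonempty W →
  ((c : Fin n → Fin n) → (∀ {x y} → Within G W x y → c x ≡ c y) →
    ∀ u v → u ∈ W → v ∈ W → c u ≡ c v) →
  ConnectedOn G W
connectedOn⁺ G W ne monochromatic with components (within? G W) (within-sym G W)
... | c , c-cong , c-path = ne , λ u v u∈ v∈ → c-path (monochromatic c c-cong u v u∈ v∈)

kConnected₁⇒connected : (G : Graph n) → KConnected 1 G → Connected G
kConnected₁⇒connected {n} G (1<n , conn) with conn ∅ (≤-reflexive (cong suc (∣⊥∣≡0 n)))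
... | (v , _) , path = connected⁺ G v λ x y →
  Star.map (proj₂ ∘ proj₂) (path x y (x∉p⇒x∈∁p ∉⊥) (x∉p⇒x∈∁p ∉⊥))

connected⇒kConnected₁ : (G : Graph n) → 1 < n → Connected G → KConnected 1 G
connected⇒kConnected₁ {n} G 1<n conn = 1<n , λ S S<1 →
  let W≡ : ∀ x → x ∈ ∁ S
      W≡ x = x∉p⇒x∈∁p (λ x∈ → ∉empty S (n<1⇒n≡0 S<1) x∈)
  in (proj₁ (proj₁ conn) , W≡ _) , λ x y _ _ →
     Star.map (λ r → W≡ _ , W≡ _ , r) (connected-path G conn x y)
  where
  ∉empty : ∀ {n} (S : Subset n) → ∣ S ∣ ≡ 0 → ∀ {x} → x ∉ S
  ∉empty (outside ∷ S) eq (Vec.there x∈) = ∉empty S eq x∈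

first-step : ∀ {R : Rel (Fin n) 0ℓ} {x y} → Star R x y → x ≢ y → ∃ (R x)
first-step ε       x≢y = contradiction refl x≢y
first-step (r ◅ _) _   = _ , r

-- Suppose v has fewer than k neighbours and delete them. As k < n, some vertex w other than v
-- survives, and a walk from v to w would begin with a step to a surviving neighbour of v.
k≤degree : ∀ {k} (G : Graph n) → KConnected k G → ∀ v → k ≤ degree G v
k≤degree {n} {k} G (k<n , conn) v with k ≤? degree G v
... | yes k≤ = k≤
... | no ¬k≤ = contradiction vy (x∈∁p⇒x∉p y∈ ∘ ∈⟦⟧⁺ (adj? G v))
  where
  near? : ∀ w → Dec (Adj G v w ⊎ w ≡ v)
  near? w = adj? G v w ⊎-dec (w F.≟ v)
  N N⁺ : Subset n
  N  = ⟦ adj? G v ⟧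
  N⁺ = ⟦ near? ⟧
  N<k : ∣ N ∣ < k
  N<k = ≤-trans (≤-reflexive (cong suc (∣⟦⟧∣≡sum (adj? G v)))) (≰⇒> ¬k≤)
  N⁺<n : ∣ N⁺ ∣ < n
  N⁺<n = begin-strict
    ∣ N⁺ ∣                                         ≡⟨ ∣⟦⟧∣≡sum near? ⟩
    sum (𝟙 ∘ near?)     ≤⟨ sum-mono (λ w → 𝟙-⊎ id (near? w) (adj? G v w) (w F.≟ v)) ⟩
    sum (λ w → 𝟙 (adj? G v w) + 𝟙 (w F.≟ v))       ≡⟨ ∑-distrib-+ (λ w → 𝟙 (adj? G v w)) _ ⟩
    degree G v + sum (λ w → 𝟙 (w F.≟ v))           ≡⟨ cong (degree G v +_) (sum-𝟙≟ v) ⟩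
    degree G v + 1                                 ≡⟨ +-comm (degree G v) 1 ⟩
    suc (degree G v)                               ≤⟨ ≰⇒> ¬k≤ ⟩
    k                                              <⟨ k<n ⟩
    n                                              ∎
    where open ≤-Reasoning
  w : Fin n
  w = proj₁ (∃-∉ N⁺ N⁺<n)
  w∉ : w ∉ N⁺
  w∉ = proj₂ (∃-∉ N⁺ N⁺<n)
  step : ∃ (Within G (∁ N) v)
  step = first-step (proj₂ (conn N N<k) v w
                      (x∉p⇒x∈∁p (Graph.irrefl G refl ∘ ∈⟦⟧⁻ (adj? G v)))
                      (x∉p⇒x∈∁p (w∉ ∘ ∈⟦⟧⁺ near? ∘ inj₁ ∘ ∈⟦⟧⁻ (adj? G v))))
                    (w∉ ∘ ∈⟦⟧⁺ near? ∘ inj₂ ∘ sym)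
  y∈ = proj₁ (proj₂ (proj₂ step))
  vy = proj₂ (proj₂ (proj₂ step))

n*k≤degreeSum : ∀ {k} (G : Graph n) → KConnected k G → n * k ≤ degreeSum G
n*k≤degreeSum {n} G conn = ≤-trans (≤-reflexive (sym (sum-const n))) (sum-mono (k≤degree G conn))

-- For n = α + k this caps independent sets at α, the maximality half of the independence number in
-- `inClass-join`.
independent-bound : ∀ {k} (G : Graph n) → KConnected k G → (T : Subset n) → Independent G T → ∣ T ∣ + k ≤ n
independent-bound {n} {k} G conn T indep with nonempty? T
... | no empty = subst (λ t → t + k ≤ n) (sym (trans (cong ∣_∣ (Empty-unique empty)) (∣⊥∣≡0 n))) (<⇒≤ (proj₁ conn))
... | yes (v , v∈) = begin
  ∣ T ∣ + k                                    ≤⟨ +-monoʳ-≤ ∣ T ∣ (k≤degree G conn v) ⟩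
  ∣ T ∣ + degree G v                           ≡⟨ cong (_+ degree G v) (∣p∣≡sum T) ⟩
  sum (λ i → 𝟙 (i ∈? T)) + degree G v          ≡⟨ ∑-distrib-+ (λ i → 𝟙 (i ∈? T)) _ ⟨
  sum (λ i → 𝟙 (i ∈? T) + 𝟙 (adj? G v i))      ≤⟨ sum-mono disjoint ⟩
  sum {n} (λ _ → 1)                            ≡⟨ sum-const n ⟩
  n * 1                               ≡⟨ *-identityʳ n ⟩
  n                                            ∎
  where
  open ≤-Reasoning
  disjoint : ∀ i → 𝟙 (i ∈? T) + 𝟙 (adj? G v i) ≤ 1
  disjoint i with i ∈? T | adj? G v i
  ... | yes i∈ | yes vi = contradiction vi (indep v i v∈ i∈)
  ... | yes _  | no _   = ≤-refl
  ... | no _   | yes _  = ≤-refl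
  ... | no _   | no _   = z≤n

kConnected-≅ : ∀ {k} (G H : Graph n) → G ≅ H → KConnected k G → KConnected k H
kConnected-≅ {n} {k} G H (φ , φ⇔) (k<n , conn) = k<n , λ S S<k →
  let pre? = λ x → to x ∈? S
      S≡ : ∣ ⟦ pre? ⟧ ∣ ≡ ∣ S ∣
      S≡ = trans (∣⟦⟧∣≡sum pre?) (trans (sym (sum-permute (λ i → 𝟙 (i ∈? S)) φ)) (sym (∣p∣≡sum S)))
      push : ∀ {x} → x ∈ ∁ ⟦ pre? ⟧ → to x ∈ ∁ S
      push x∈ = x∉p⇒x∈∁p (x∈∁p⇒x∉p x∈ ∘ ∈⟦⟧⁺ pre?)
      pull : ∀ {y} → y ∈ ∁ S → from y ∈ ∁ ⟦ pre? ⟧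
      pull {y} y∈ = x∉p⇒x∈∁p (x∈∁p⇒x∉p y∈ ∘ subst (_∈ S) (Inverse.strictlyInverseˡ φ y) ∘ ∈⟦⟧⁻ pre?)
      ((w , w∈) , path) = conn ⟦ pre? ⟧ (subst (_< k) (sym S≡) S<k)
  in (to w , push w∈) , λ u v u∈ v∈ →
     subst₂ (Star (Within H (∁ S))) (Inverse.strictlyInverseˡ φ u) (Inverse.strictlyInverseˡ φ v)
       (Star.gmap to (λ (x∈ , y∈ , xy) → push x∈ , push y∈ , Equivalence.to (φ⇔ _ _) xy)
         (path (from u) (from v) (pull u∈) (pull v∈)))
  where open Inverse φ using (to; from)

-- Splitting off an independent set

record Partition {n} (p : Subset n) (a b : ℕ) : Set where
  field
    bijection : Fin n ↔ (Fin a ⊎ Fin b)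
  open Inverse bijection public using (to; from; strictlyInverseˡ; strictlyInverseʳ)
  field
    -- Membership is recorded along `from`, since `decompose` reads the adjacencies of H and of the
    -- join off G through `from`.
    from₁∈ : ∀ i → from (inj₁ i) ∈ p
    from₂∉ : ∀ j → from (inj₂ j) ∉ p

partition : (p : Subset n) → Partition p ∣ p ∣ ∣ ∁ p ∣
partition [] = record { bijection = mk↔ₛ′ (λ ()) (λ { (inj₁ ()) ; (inj₂ ()) }) (λ { (inj₁ ()) ; (inj₂ ()) }) (λ ())
                      ; from₁∈ = λ () ; from₂∉ = λ () }
partition (inside ∷ p) = record
  { bijection = mk↔ₛ′ to′ from′ to-from from-to
  ; from₁∈ = λ { zero → Vec.here ; (suc i) → Vec.there (from₁∈ i) }
  ; from₂∉ = λ { j (Vec.there x∈) → from₂∉ j x∈ }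
  }
  where
  open Partition (partition p)
  to′ : Fin _ → Fin (suc ∣ p ∣) ⊎ Fin ∣ ∁ p ∣
  to′ zero    = inj₁ zero
  to′ (suc x) = Sum.map suc id (to x)
  from′ : Fin (suc ∣ p ∣) ⊎ Fin ∣ ∁ p ∣ → Fin _
  from′ (inj₁ zero)    = zero
  from′ (inj₁ (suc i)) = suc (from (inj₁ i))
  from′ (inj₂ j)       = suc (from (inj₂ j))
  to-from : ∀ y → to′ (from′ y) ≡ y
  to-from (inj₁ zero)    = refl
  to-from (inj₁ (suc i)) rewrite strictlyInverseˡ (inj₁ i) = refl
  to-from (inj₂ j)       rewrite strictlyInverseˡ (inj₂ j) = refl
  from-map : ∀ y → from′ (Sum.map suc id y) ≡ suc (from y)
  from-map (inj₁ _) = refl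
  from-map (inj₂ _) = refl
  from-to : ∀ x → from′ (to′ x) ≡ x
  from-to zero    = refl
  from-to (suc x) = trans (from-map (to x)) (cong suc (strictlyInverseʳ x))
partition (outside ∷ p) = record
  { bijection = mk↔ₛ′ to′ from′ to-from from-to
  ; from₁∈ = λ i → Vec.there (from₁∈ i)
  ; from₂∉ = λ { zero () ; (suc j) (Vec.there x∈) → from₂∉ j x∈ }
  }
  where
  open Partition (partition p)
  to′ : Fin _ → Fin ∣ p ∣ ⊎ Fin (suc ∣ ∁ p ∣)
  to′ zero    = inj₂ zero
  to′ (suc x) = Sum.map id suc (to x)
  from′ : Fin ∣ p ∣ ⊎ Fin (suc ∣ ∁ p ∣) → Fin _
  from′ (inj₂ zero)    = zero
  from′ (inj₁ i)       = suc (from (inj₁ i))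
  from′ (inj₂ (suc j)) = suc (from (inj₂ j))
  to-from : ∀ y → to′ (from′ y) ≡ y
  to-from (inj₂ zero)    = refl
  to-from (inj₁ i)       rewrite strictlyInverseˡ (inj₁ i) = refl
  to-from (inj₂ (suc j)) rewrite strictlyInverseˡ (inj₂ j) = refl
  from-map : ∀ y → from′ (Sum.map id suc y) ≡ suc (from y)
  from-map (inj₁ _) = refl
  from-map (inj₂ _) = refl
  from-to : ∀ x → from′ (to′ x) ≡ x
  from-to zero    = refl
  from-to (suc x) = trans (from-map (to x)) (cong suc (strictlyInverseʳ x))

-- A vertex u of S and a vertex w outside S are adjacent, for otherwise
-- deleting the k - 1 other vertices outside S would isolate u from w.
decompose : ∀ {α k} (G : Graph (α + k)) → KConnected k G → (S : Subset (α + k)) →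
  Independent G S → ∣ S ∣ ≡ α → Σ[ H ∈ Graph k ] (G ≅ (K̄ α ∨ H))
decompose {α} {k} G (k<n , conn) S indep S≡α =
  H , mk↔ₛ′ (join α k ∘ to) (from ∘ splitAt α)
            (λ y → trans (cong (join α k) (strictlyInverseˡ (splitAt α y))) (join-splitAt α k y))
            (λ x → trans (cong from (splitAt-join α k (to x))) (strictlyInverseʳ x)) ,
  adj⇔
  where
  ∁S≡k : ∣ ∁ S ∣ ≡ k
  ∁S≡k = trans (∣∁p∣≡n∸∣p∣ S) (trans (cong (α + k ∸_) S≡α) (m+n∸m≡n α k))
  open Partition (subst₂ (Partition S) S≡α ∁S≡k (partition S))

  H : Graph k
  H = record
    { Adj    = λ i j → Adj G (from (inj₂ i)) (from (inj₂ j))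
    ; adj?   = λ i j → adj? G (from (inj₂ i)) (from (inj₂ j))
    ; sym    = Graph.sym G
    ; irrefl = λ { refl → Graph.irrefl G refl }
    }
  open Join (K̄ α) H

  cross : ∀ {u w} → u ∈ S → w ∉ S → Adj G u w
  cross {u} {w} u∈ w∉ = conclude (first-step (proj₂ (conn D D<k) u w
      (x∉p⇒x∈∁p (λ u∈D → proj₁ (∈⟦⟧⁻ D? u∈D) u∈)) (x∉p⇒x∈∁p (λ w∈D → proj₂ (∈⟦⟧⁻ D? w∈D) refl)))
      (λ { refl → w∉ u∈ }))
    where
    D? = λ x → ¬? (x ∈? S) ×-dec ¬? (x F.≟ w)
    D = ⟦ D? ⟧
    D<k : ∣ D ∣ < k
    D<k = subst (∣ D ∣ <_) ∁S≡k (subst₂ _<_ (sym (∣⟦⟧∣≡sum D?)) (sym (∣p∣≡sum (∁ S)))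
      (sum-mono-< (λ x → 𝟙-mono (x∉p⇒x∈∁p ∘ proj₁) (D? x) (x ∈? ∁ S)) w
        (≤-reflexive (trans (cong suc (𝟙-no (D? w) (λ d → proj₂ d refl)))
                            (sym (𝟙-yes (w ∈? ∁ S) (x∉p⇒x∈∁p w∉)))))))
    conclude : ∃ (Within G (∁ D) u) → Adj G u w
    conclude (y , _ , y∈ , uy) with y ∈? S | y F.≟ w
    ... | yes y∈S | _        = contradiction uy (indep u y u∈ y∈S)
    ... | no _    | yes refl = uy
    ... | no y∉   | no y≢w   = contradiction (∈⟦⟧⁺ D? (y∉ , y≢w)) (x∈∁p⇒x∉p y∈)

  from⇔ : ∀ a b → Adj G (from a) (from b) ⇔ JoinAdj a b
  from⇔ (inj₁ i) (inj₁ j) = mk⇔ (indep _ _ (from₁∈ i) (from₁∈ j)) λ ()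
  from⇔ (inj₁ i) (inj₂ j) = mk⇔ _ λ _ → cross (from₁∈ i) (from₂∉ j)
  from⇔ (inj₂ i) (inj₁ j) = mk⇔ _ λ _ → Graph.sym G (cross (from₁∈ j) (from₂∉ i))
  from⇔ (inj₂ i) (inj₂ j) = mk⇔ id id

  adj⇔ : ∀ u v → Adj G u v ⇔ JoinAdj (splitAt α (join α k (to u))) (splitAt α (join α k (to v)))
  adj⇔ u v = subst₂ _⇔_ (cong₂ (Adj G) (strictlyInverseʳ u) (strictlyInverseʳ v))
    (cong₂ JoinAdj (sym (splitAt-join α k (to u))) (sym (splitAt-join α k (to v))))
    (from⇔ (to u) (to v))

-- The join with an edgeless graph

data Split m {n} : Fin (m + n) → Set where
  left  : (i : Fin m) → Split m (i ↑ˡ n)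
  right : (j : Fin n) → Split m (m ↑ʳ j)

split : ∀ m {n} (x : Fin (m + n)) → Split m x
split m {n} x = subst (Split m) (join-splitAt m n x) (go (splitAt m x))
  where
  go : ∀ y → Split m (join m n y)
  go (inj₁ i) = left i
  go (inj₂ j) = right j

module _ {α k d : ℕ} (α+d≡k : α + d ≡ k) (1≤α : 1 ≤ α) (H : Graph k) where

  private
    J : Graph (α + k)
    J = K̄ α ∨ H

    d<k : d < k
    d<k = ≤-trans (+-monoˡ-≤ d 1≤α) (≤-reflexive α+d≡k)

    left≁left : ∀ i j → ¬ Adj J (i ↑ˡ k) (j ↑ˡ k)
    left≁left i j rewrite splitAt-↑ˡ α i k | splitAt-↑ˡ α j k = λ ()

    left∼right : ∀ i j → Adj J (i ↑ˡ k) (α ↑ʳ j)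
    left∼right i j rewrite splitAt-↑ˡ α i k | splitAt-↑ʳ α k j = tt

    right∼right⁺ : ∀ {i j} → Adj H i j → Adj J (α ↑ʳ i) (α ↑ʳ j)
    right∼right⁺ {i} {j} ij rewrite splitAt-↑ʳ α k i | splitAt-↑ʳ α k j = ij

    right∼right⁻ : ∀ {i j} → Adj J (α ↑ʳ i) (α ↑ʳ j) → Adj H i j
    right∼right⁻ {i} {j} ij rewrite splitAt-↑ʳ α k i | splitAt-↑ʳ α k j = ij

  -- The set deleted from the join is S together with all of K̄ α: it has α + ∣ S ∣ < α + d = k
  -- elements, and what survives lies in H.
  kConnected-join⁻ : KConnected k J → KConnected d H
  kConnected-join⁻ (_ , conn) = d<k , λ S S<d →
    let
      P : Fin α ⊎ Fin k → Set
      P = Sum.[ (λ _ → ⊤) , _∈ S ]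
      P? : ∀ y → Dec (P y)
      P? = Sum.[ (λ _ → yes tt) , _∈? S ]
      X? = λ x → P? (splitAt α x)
      X = ⟦ X? ⟧
      X≡ : ∣ X ∣ ≡ α + ∣ S ∣
      X≡ = trans (∣⟦⟧∣≡sum X?) (trans (sum-++ α (𝟙 ∘ X?)) (cong₂ _+_
        (trans (sum-cong-≗ λ i → cong (𝟙 ∘ P?) (splitAt-↑ˡ α i k)) (trans (sum-const α) (*-identityʳ α)))
        (trans (sum-cong-≗ λ j → cong (𝟙 ∘ P?) (splitAt-↑ʳ α k j)) (sym (∣p∣≡sum S)))))
      left∈X : ∀ i → i ↑ˡ k ∈ X
      left∈X i = ∈⟦⟧⁺ X? (subst P (sym (splitAt-↑ˡ α i k)) tt)
      pull : ∀ {j} → α ↑ʳ j ∈ ∁ X → j ∈ ∁ S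
      pull {j} j∈ = x∉p⇒x∈∁p (x∈∁p⇒x∉p j∈ ∘ ∈⟦⟧⁺ X? ∘ subst P (sym (splitAt-↑ʳ α k j)))
      push : ∀ {j} → j ∈ ∁ S → α ↑ʳ j ∈ ∁ X
      push {j} j∈ = x∉p⇒x∈∁p (x∈∁p⇒x∉p j∈ ∘ subst P (splitAt-↑ʳ α k j) ∘ ∈⟦⟧⁻ X?)
      ((w , w∈) , path) = conn X (subst₂ _<_ (sym X≡) α+d≡k (+-monoʳ-< α S<d))
    in nonempty S X left∈X pull (split α w) w∈ ,
       λ u v u∈ v∈ → restrict S X left∈X pull (path (α ↑ʳ u) (α ↑ʳ v) (push u∈) (push v∈)) refl refl
    where
    module _ (S : Subset k) (X : Subset (α + k)) (left∈X : ∀ i → i ↑ˡ k ∈ X)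
             (pull : ∀ {j} → α ↑ʳ j ∈ ∁ X → j ∈ ∁ S) where
      nonempty : ∀ {x} → Split α x → x ∈ ∁ X → Nonempty (∁ S)
      nonempty (left i)  x∈ = contradiction (left∈X i) (x∈∁p⇒x∉p x∈)
      nonempty (right j) x∈ = j , pull x∈

      restrict : ∀ {x y u v} → Star (Within J (∁ X)) x y → α ↑ʳ u ≡ x → α ↑ʳ v ≡ y →
                 Star (Within H (∁ S)) u v
      restrict {u = u} ε refl eq = subst (Star _ u) (sym (F.↑ʳ-injective α _ _ eq)) ε
      restrict (_◅_ {j = z} (x∈ , z∈ , xz) ss) refl eq with split α z
      ... | left i  = contradiction (left∈X i) (x∈∁p⇒x∉p z∈)
      ... | right j = (pull x∈ , pull z∈ , right∼right⁻ xz) ◅ restrict ss refl eq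

  -- Fewer than k deletions spare some vertex of H, the hub. If a vertex of K̄ α survives as well,
  -- it is adjacent to all of H, so every vertex reaches the hub in at most two steps. Otherwise α
  -- deletions went to K̄ α, fewer than d are left for H, and H stays connected.
  kConnected-join⁺ : KConnected d H → KConnected k J
  kConnected-join⁺ (_ , conn) = m<n+m k 1≤α , connectedOn
    where
    module _ (X : Subset (α + k)) (X<k : ∣ X ∣ < k) where
      X₁? : ∀ i → Dec (i ↑ˡ k ∈ X)
      X₁? i = (i ↑ˡ k) ∈? X
      X₂? : ∀ j → Dec (α ↑ʳ j ∈ X)
      X₂? j = (α ↑ʳ j) ∈? X
      X₁ = ⟦ X₁? ⟧
      X₂ = ⟦ X₂? ⟧
      X≡ : ∣ X ∣ ≡ ∣ X₁ ∣ + ∣ X₂ ∣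
      X≡ = trans (∣p∣≡sum X) (trans (sum-++ α _)
             (sym (cong₂ _+_ (∣⟦⟧∣≡sum X₁?) (∣⟦⟧∣≡sum X₂?))))

      left∈ : ∀ {i} → i ∉ X₁ → i ↑ˡ k ∈ ∁ X
      left∈ i∉ = x∉p⇒x∈∁p (i∉ ∘ ∈⟦⟧⁺ X₁?)

      right∈ : ∀ {j} → j ∉ X₂ → α ↑ʳ j ∈ ∁ X
      right∈ j∉ = x∉p⇒x∈∁p (j∉ ∘ ∈⟦⟧⁺ X₂?)

      hub : ∃ (_∉ X₂)
      hub = ∃-∉ X₂ (≤-<-trans (≤-trans (m≤n+m ∣ X₂ ∣ ∣ X₁ ∣) (≤-reflexive (sym X≡))) X<k)

      j = proj₁ hub
      j∈ = right∈ (proj₂ hub)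

      throughHub : ∃ (_∉ X₁) → ConnectedOn J (∁ X)
      throughHub (i , i∉) = (α ↑ʳ j , j∈) , λ u v u∈ v∈ →
        toHub (split α u) u∈ ◅◅ Star.reverse (within-sym J (∁ X)) (toHub (split α v) v∈)
        where
        toHub : ∀ {x} → Split α x → x ∈ ∁ X → Star (Within J (∁ X)) x (α ↑ʳ j)
        toHub (left i′)  x∈ = (x∈ , j∈ , left∼right i′ j) ◅ ε
        toHub (right j′) x∈ = (x∈ , left∈ i∉ , Graph.sym J {i ↑ˡ k} {α ↑ʳ j′} (left∼right i j′)) ◅
                              (left∈ i∉ , j∈ , left∼right i j) ◅ ε

      insideH : α ≤ ∣ X₁ ∣ → ConnectedOn J (∁ X)
      insideH α≤X₁ = (α ↑ʳ j , j∈) , λ u v → path (split α u) (split α v)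
        where
        X₂<d : ∣ X₂ ∣ < d
        X₂<d = +-cancelˡ-< α ∣ X₂ ∣ d (≤-<-trans (+-monoˡ-≤ ∣ X₂ ∣ α≤X₁)
                 (subst₂ _<_ X≡ (sym α+d≡k) X<k))
        X₁≡full : X₁ ≡ full
        X₁≡full = ∣p∣≡n⇒p≡⊤ (≤-antisym (∣p∣≤n X₁) α≤X₁)
        left∈X : ∀ i → i ↑ˡ k ∈ X
        left∈X i = ∈⟦⟧⁻ X₁? (subst (i ∈_) (sym X₁≡full) ∈⊤)
        pull : ∀ {j} → α ↑ʳ j ∈ ∁ X → j ∈ ∁ X₂
        pull j∈ = x∉p⇒x∈∁p (x∈∁p⇒x∉p j∈ ∘ ∈⟦⟧⁻ X₂?)
        path : ∀ {u v} → Split α u → Split α v → u ∈ ∁ X → v ∈ ∁ X → Star (Within J (∁ X)) u v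
        path (left i) _ u∈ _ = contradiction (left∈X i) (x∈∁p⇒x∉p u∈)
        path _ (left i) _ v∈ = contradiction (left∈X i) (x∈∁p⇒x∉p v∈)
        path (right i) (right j) u∈ v∈ =
          Star.gmap (α ↑ʳ_) (λ (x∈ , y∈ , xy) → right∈ (x∈∁p⇒x∉p x∈) , right∈ (x∈∁p⇒x∉p y∈) , right∼right⁺ xy)
            (proj₂ (conn X₂ X₂<d) i j (pull u∈) (pull v∈))

      connectedOn : ConnectedOn J (∁ X)
      connectedOn with ∣ X₁ ∣ <? α
      ... | yes X₁<α = throughHub (∃-∉ X₁ X₁<α)
      ... | no  X₁≮α = insideH (≮⇒≥ X₁≮α)

  inClass-join : KConnected d H → InClass α k J
  inClass-join conn = connJ , (L , independent , L≡α) , λ { _ (T , indep , refl) →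
      +-cancelʳ-≤ k ∣ T ∣ α (independent-bound J connJ T indep) }
    where
    connJ = kConnected-join⁺ conn
    IsLeft : Fin α ⊎ Fin k → Set
    IsLeft = Sum.[ (λ _ → ⊤) , (λ _ → ⊥) ]
    isLeft? : ∀ y → Dec (IsLeft y)
    isLeft? = Sum.[ (λ _ → yes tt) , (λ _ → no λ ()) ]
    L? = λ x → isLeft? (splitAt α x)
    L = ⟦ L? ⟧
    L≡α : ∣ L ∣ ≡ α
    L≡α = trans (∣⟦⟧∣≡sum L?) (trans (sum-++ α (𝟙 ∘ L?)) (trans (cong₂ _+_
      (trans (sum-cong-≗ λ i → cong (𝟙 ∘ isLeft?) (splitAt-↑ˡ α i k)) (trans (sum-const α) (*-identityʳ α)))
      (trans (sum-cong-≗ λ j → cong (𝟙 ∘ isLeft?) (splitAt-↑ʳ α k j)) (trans (sum-const k) (*-zeroʳ k))))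
      (+-identityʳ α)))
    nonadjacent : ∀ {u v} → Split α u → Split α v → IsLeft (splitAt α u) → IsLeft (splitAt α v) → ¬ Adj J u v
    nonadjacent (left i) (left j) _ _ = left≁left i j
    nonadjacent (right i) _ u v rewrite splitAt-↑ʳ α k i = ⊥-elim u
    nonadjacent _ (right j) u v rewrite splitAt-↑ʳ α k j = ⊥-elim v
    independent : Independent J L
    independent u v u∈ v∈ = nonadjacent (split α u) (split α v) (∈⟦⟧⁻ L? u∈) (∈⟦⟧⁻ L? v∈)

-- Cyclic two-colourings

least : {P : ℕ → Set} → U.Decidable P → ∀ l → P l →
  ∃[ a ] a ≤ l × P a × (∀ {i} → i < a → ¬ P i)
least P? zero    pl = zero , z≤n , pl , λ ()
least P? (suc l) pl with P? 0
... | yes p0 = 0 , z≤n , p0 , λ ()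
... | no ¬p0 with least (P? ∘ suc) l pl
...   | a , a≤l , pa , before = suc a , s≤s a≤l , pa , λ { {zero} _ → ¬p0 ; {suc i} i<a → before (s≤s⁻¹ i<a) }

-- `nothing' marks a deleted position.
Colouring : Set
Colouring = ℕ → Maybe Bool

private variable
  s : Colouring

infixl 6 _↟_

_↟_ : Colouring → ℕ → Colouring
(s ↟ a) i = s (a + i)

Agree : Colouring → ℕ → ℕ → Set
Agree s i j = ∀ {x y} → s i ≡ just x → s j ≡ just y → x ≡ y

Periodic : ℕ → Colouring → Set
Periodic n s = ∀ i → s (n + i) ≡ s i

Close : ℕ → Colouring → Set
Close m s = ∀ i j → j ≤ m → Agree s i (i + j)

-- A disjunction, because for odd n only one of the two nearly diametral chords is guaranteed at a
-- given position.
Far : ℕ → ℕ → Colouring → Set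
Far h h′ s = ∀ i → Agree s i (i + h) ⊎ Agree s i (i + h′)

gap : Maybe Bool → ℕ
gap nothing  = 1
gap (just _) = 0

gaps : Colouring → ℕ → ℕ
gaps s zero    = 0
gaps s (suc l) = gap (s 0) + gaps (s ∘ suc) l

gaps-+ : ∀ s a b → gaps s (a + b) ≡ gaps s a + gaps (s ↟ a) b
gaps-+ s zero    b = refl
gaps-+ s (suc a) b = trans (cong (gap (s 0) +_) (gaps-+ (s ∘ suc) a b)) (sym (+-assoc (gap (s 0)) _ _))

gaps-cong : ∀ {s s′} → (∀ i → s i ≡ s′ i) → ∀ l → gaps s l ≡ gaps s′ l
gaps-cong eq zero    = refl
gaps-cong eq (suc l) = cong₂ _+_ (cong gap (eq 0)) (gaps-cong (eq ∘ suc) l)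

gaps-full : ∀ s m → (∀ {j} → j < m → s j ≡ nothing) → gaps s m ≡ m
gaps-full s zero    all = refl
gaps-full s (suc m) all rewrite all {0} (s≤s z≤n) = cong suc (gaps-full (s ∘ suc) m (all ∘ s≤s))

gaps≡0 : ∀ s l → gaps s l ≡ 0 → ∀ {i} → i < l → ∃[ x ] s i ≡ just x
gaps≡0 s (suc l) eq {i} i<l with s 0 in s0
gaps≡0 s (suc l) eq {zero}  i<l | just x = x , s0
gaps≡0 s (suc l) eq {suc i} i<l | just x = gaps≡0 (s ∘ suc) l eq (s≤s⁻¹ i<l)

shift-close : ∀ {m} a → Close m s → Close m (s ↟ a)
shift-close {s} a close i j j≤m rewrite sym (+-assoc a i j) = close (a + i) j j≤m

shift-far : ∀ {h h′} a → Far h h′ s → Far h h′ (s ↟ a)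
shift-far {s} {h} {h′} a far i rewrite sym (+-assoc a i h) | sym (+-assoc a i h′) = far (a + i)

shift-periodic : ∀ {n} a → Periodic n s → Periodic n (s ↟ a)
shift-periodic {s} {n} a per i = trans (cong s (swap a n i)) (per (a + i))
  where
  swap : ∀ a n i → a + (n + i) ≡ n + (a + i)
  swap = solve-∀

-- Every window of one period contains the same number of gaps, so the origin may be moved to a
-- vertex of choice.
gaps-shift : ∀ {n} a → Periodic n s → gaps (s ↟ a) n ≡ gaps s n
gaps-shift {s} {n} a per = +-cancelˡ-≡ (gaps s a) _ _ (begin
  gaps s a + gaps (s ↟ a) n   ≡⟨ gaps-+ s a n ⟨
  gaps s (a + n)              ≡⟨ cong (gaps s) (+-comm a n) ⟩
  gaps s (n + a)              ≡⟨ gaps-+ s n a ⟩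
  gaps s n + gaps (s ↟ n) a   ≡⟨ cong (gaps s n +_) (gaps-cong per a) ⟩
  gaps s n + gaps s a         ≡⟨ +-comm (gaps s n) _ ⟩
  gaps s a + gaps s n         ∎)
  where open ≡-Reasoning

-- The first change of colour, from a run to y at position run + m; the m
-- positions before it are deleted, as they would be close to it otherwise.
record Change (m : ℕ) (s : Colouring) (y : Bool) (l : ℕ) : Set where
  field
    run         : ℕ
    1≤run       : 1 ≤ run
    within      : run + m ≤ l
    arrives     : s (run + m) ≡ just y
    before      : ∀ {i} → i < run + m → s i ≢ just y
    deleted     : ∀ {j} → j < m → s (run + j) ≡ nothing

change : ∀ {m x y} → Close m s → x ≢ y → ∀ l → s 0 ≡ just x → s l ≡ just y → Change m s y l
change {s} {m} {x} {y} close x≢y l s0 sl with least (λ i → Maybe.≡-dec Bool._≟_ (s i) (just y)) l sl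
... | a , a≤l , sa , before with a ≤? m
-- A first y within distance m of the origin would have the colour of the origin; hence the run
-- before the deleted block is nonempty.
...   | yes a≤m = contradiction (close 0 a a≤m s0 sa) x≢y
...   | no a≰m with m≤n⇒∃[o]m+o≡n (≰⇒> a≰m)
...     | t , refl = record
  { run     = suc t
  ; 1≤run   = s≤s z≤n
  ; within  = subst (_≤ l) a≡ a≤l
  ; arrives = subst (λ b → s b ≡ just y) a≡ sa
  ; before  = λ {i} i< → before (subst (i <_) (sym a≡) i<)
  ; deleted = deleted
  }
  where
  a≡ : suc (m + t) ≡ suc (t + m)
  a≡ = cong suc (+-comm m t)
  deleted : ∀ {j} → j < m → s (suc t + j) ≡ nothing
  deleted {j} j<m with s (suc t + j) in eq
  ... | nothing = refl
  ... | just z with m≤n⇒∃[o]m+o≡n (<⇒≤ j<m)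
  ...   | e , refl = contradiction
    (trans eq (cong just (close (suc t + j) e (m≤n+m e j) eq (trans (cong s (reassoc j t e)) sa))))
    (before (s≤s (subst (t + j <_) (+-comm t m) (+-monoʳ-< t j<m))))
    where
    reassoc : ∀ j t e → suc t + j + e ≡ suc (j + e + t)
    reassoc = solve-∀

colour-≢ : ∀ {x y z : Bool} → x ≢ y → z ≢ y → z ≡ x
colour-≢ {true}  {true}          x≢y _   = contradiction refl x≢y
colour-≢ {false} {false}         x≢y _   = contradiction refl x≢y
colour-≢ {true}  {false} {true}  _   _   = refl
colour-≢ {true}  {false} {false} _   z≢y = contradiction refl z≢y
colour-≢ {false} {true}  {false} _   _   = refl
colour-≢ {false} {true}  {true}  _   z≢y = contradiction refl z≢y

module _ {n m h h′ : ℕ} (h+h′≡n : h + h′ ≡ n) (h≤h′ : h ≤ h′) (h′≤1+h : h′ ≤ suc h) (m<h : m < h) where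

  -- The position i = (p + m) ∸ h of the shorter run has both i + h and i + h′ in
  -- the other run; parity of n excludes p = t = 1 when h′ = 1 + h.
  facing-runs : ∀ {x y} p t → Far h h′ s → 1 ≤ p → p ≤ t → p + m + t + m ≡ n →
    (∀ {i} → i < p → s i ≡ just y) → (∀ {i} → i < t → s (p + m + i) ≡ just x) → y ≡ x
  facing-runs {s} {x} {y} p t far 1≤p p≤t total run₁ run₂ with p + m ≤? h
  ... | yes p+m≤h with m≤n⇒∃[o]m+o≡n p+m≤h | m≤n⇒∃[o]m+o≡n (≤-trans p+m≤h h≤h′)
  ...   | u , refl | u′ , refl =
    Sum.[ (λ agree → agree (run₁ 1≤p) (run₂ u<t)) , (λ agree → agree (run₁ 1≤p) (run₂ u′<t)) ] (far 0)
    where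
    -- From position 0 the two candidates lie at offsets u and u′ of the other run. Cancelling p + m
    -- + m in h + h′ = n gives this equation, and 1 ≤ p then puts both offsets below t.
    t≡ : p + (u + u′) ≡ t
    t≡ = +-cancelʳ-≡ (p + m + m) (p + (u + u′)) t (trans (lhs p m u u′) (trans h+h′≡n (trans (sym total) (rhs p m t))))
      where
      lhs : ∀ p m u u′ → p + (u + u′) + (p + m + m) ≡ p + m + u + (p + m + u′)
      lhs = solve-∀
      rhs : ∀ p m t → p + m + t + m ≡ t + (p + m + m)
      rhs = solve-∀
    u<t : u < t
    u<t = ≤-trans (+-mono-≤ 1≤p (m≤m+n u u′)) (≤-reflexive t≡)
    u′<t : u′ < t
    u′<t = ≤-trans (+-mono-≤ 1≤p (m≤n+m u′ u)) (≤-reflexive t≡)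
  facing-runs {s} {x} {y} p t far 1≤p p≤t total run₁ run₂ | no p+m≰h
    with m≤n⇒∃[o]m+o≡n (<⇒≤ (≰⇒> p+m≰h)) | m≤n⇒∃[o]m+o≡n h≤h′
  -- From i the two candidates lie at offsets 0 and e = h′ - h of the other run.
  ... | i , h+i≡ | e , refl = Sum.[
      (λ agree → agree (run₁ i<p)
        (at 0 (≤-trans 1≤p p≤t) (trans (+-comm i h) (trans h+i≡ (sym (+-identityʳ _))))))
    , (λ agree → agree (run₁ i<p) (at e e<t (trans (reassoc i h e) (cong (_+ e) h+i≡))))
    ] (far i)
    where
    reassoc : ∀ i h e → i + (h + e) ≡ h + i + e
    reassoc = solve-∀
    at : ∀ {j} u → u < t → j ≡ p + m + u → s j ≡ just x
    at u u<t refl = run₂ u<t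
    -- Here i = p + m - h, so `m < h` is what keeps i inside the shorter run.
    i<p : i < p
    i<p = +-cancelʳ-< m i p (subst (i + m <_) (trans (+-comm i h) h+i≡) (+-monoʳ-< i m<h))
    e≤1 : e ≤ 1
    e≤1 = +-cancelˡ-≤ h e 1 (≤-trans h′≤1+h (≤-reflexive (+-comm 1 h)))
    parity : ∀ e p t → e ≤ 1 → 1 ≤ p → p ≤ t → h + (h + e) ≡ p + m + t + m → e < t
    parity zero p t _ 1≤p p≤t _ = ≤-trans 1≤p p≤t
    parity (suc zero) p (suc (suc t)) _ _ _ _ = s≤s (s≤s z≤n)
    parity (suc zero) (suc zero) (suc zero) _ _ _ eq = contradiction
      (trans (double m) (trans (sym eq) (odd h))) (even≢odd (suc m) h)
      where
      double : ∀ m → 2 * suc m ≡ 1 + m + 1 + m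
      double = solve-∀
      odd : ∀ h → h + (h + 1) ≡ suc (2 * h)
      odd = solve-∀
    parity (suc zero) (suc (suc _)) (suc zero) _ _ (s≤s ()) _
    parity (suc zero) (suc _) zero _ _ () _
    parity (suc zero) zero zero _ () _ _
    parity (suc (suc _)) _ _ (s≤s ()) _ _ _
    e<t : e < t
    e<t = parity e p t e≤1 1≤p p≤t (trans h+h′≡n (sym total))

-- X is the change from x to y and Y the next one back to x; the three stretches
-- outside the two blocks of m deleted positions have lengths X.run, Y.run, q.
module TwoChanges {n m : ℕ} {s : Colouring} {x y : Bool} (x≢y : x ≢ y)
  (per : Periodic n s) (close : Close m s) (s0 : s 0 ≡ just x)
  {l : ℕ} (X : Change m s y l) (r : ℕ) (a+r≡n : Change.run X + m + r ≡ n)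
  (Y : Change m (s ↟ (Change.run X + m)) x r) (q : ℕ) (b+q≡r : Change.run Y + m + q ≡ r)
  where

  private
    module X = Change X
    module Y = Change Y

    a b : ℕ
    a = X.run + m
    b = Y.run + m

    s′ s″ : Colouring
    s′ = s ↟ a
    s″ = s′ ↟ b

    n≡ : n ≡ a + (b + q)
    n≡ = sym (trans (cong (a +_) b+q≡r) a+r≡n)

    e₁ e₂ e₃ : ℕ
    e₁ = gaps s X.run
    e₂ = gaps s′ Y.run
    e₃ = gaps s″ q

    gaps≡ : gaps s n ≡ (m + m) + (e₁ + (e₂ + e₃))
    gaps≡ = begin
      gaps s n                             ≡⟨ cong (gaps s) n≡ ⟩
      gaps s (a + (b + q))                 ≡⟨ gaps-+ s a (b + q) ⟩
      gaps s a + gaps s′ (b + q)           ≡⟨ cong (gaps s a +_) (gaps-+ s′ b q) ⟩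
      gaps s a + (gaps s′ b + e₃)          ≡⟨ cong₂ (λ u v → u + (v + e₃))
        (trans (gaps-+ s X.run m) (cong (e₁ +_) (gaps-full (s ↟ X.run) m X.deleted)))
        (trans (gaps-+ s′ Y.run m) (cong (e₂ +_) (gaps-full (s′ ↟ Y.run) m Y.deleted))) ⟩
      e₁ + m + (e₂ + m + e₃)               ≡⟨ rearrange e₁ e₂ e₃ m ⟩
      (m + m) + (e₁ + (e₂ + e₃))           ∎
      where
      open ≡-Reasoning
      rearrange : ∀ e₁ e₂ e₃ m → e₁ + m + (e₂ + m + e₃) ≡ (m + m) + (e₁ + (e₂ + e₃))
      rearrange = solve-∀

  2m≤gaps : m + m ≤ gaps s n
  2m≤gaps = ≤-trans (m≤m+n (m + m) _) (≤-reflexive (sym gaps≡))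

  module _ (1≤m : 1 ≤ m) (gaps≤2m : gaps s n ≤ m + m) where
    private
      e≡0 : e₁ + (e₂ + e₃) ≡ 0
      e≡0 = n≤0⇒n≡0 (+-cancelˡ-≤ (m + m) _ 0
        (≤-trans (≤-reflexive (sym gaps≡)) (≤-trans gaps≤2m (≤-reflexive (sym (+-identityʳ (m + m)))))))
      e₁≡0 : e₁ ≡ 0
      e₁≡0 = m+n≡0⇒m≡0 e₁ e≡0
      e₂≡0 : e₂ ≡ 0
      e₂≡0 = m+n≡0⇒m≡0 e₂ (m+n≡0⇒n≡0 e₁ e≡0)
      e₃≡0 : e₃ ≡ 0
      e₃≡0 = m+n≡0⇒n≡0 e₂ (m+n≡0⇒n≡0 e₁ e≡0)

      run-x : ∀ {i} → i < X.run → s i ≡ just x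
      run-x i< with gaps≡0 s X.run e₁≡0 i<
      ... | z , eq = trans eq (cong just (colour-≢ x≢y
        (λ z≡y → X.before (≤-trans i< (m≤m+n X.run m)) (trans eq (cong just z≡y)))))

      run-y : ∀ {i} → i < Y.run → s′ i ≡ just y
      run-y i< with gaps≡0 s′ Y.run e₂≡0 i<
      ... | z , eq = trans eq (cong just (colour-≢ (x≢y ∘ sym)
        (λ z≡x → Y.before (≤-trans i< (m≤m+n Y.run m)) (trans eq (cong just z≡x)))))

      close″ : Close m s″
      close″ = shift-close {s′} b (shift-close {s} a close)

      -- No later change delimits this stretch, so its colour is carried from `Y.arrives` one
      -- position at a time, by closeness at distance 1; this is where `1 ≤ m` enters.
      tail-x : ∀ {i} → i < q → s″ i ≡ just x
      tail-x {zero}  _  = trans (cong s′ (+-identityʳ b)) Y.arrives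
      tail-x {suc i} i< with gaps≡0 s″ q e₃≡0 i<
      ... | z , eq = trans eq (cong just (sym (close″ i 1 1≤m (tail-x (<-trans (n<1+n i) i<))
                                                 (trans (cong s″ (+-comm i 1)) eq))))

      -- The stretch after the second block continues around the cycle into the first stretch, so
      -- the two form a single run of x.
      t : ℕ
      t = q + X.run

      run-x″ : ∀ {i} → i < t → s″ i ≡ just x
      run-x″ {i} i< with i <? q
      ... | yes i<q = tail-x i<q
      ... | no i≮q with m≤n⇒∃[o]m+o≡n (≮⇒≥ i≮q)
      ...   | j , refl = trans (cong s (trans (reassoc a b q j) (cong (_+ j) (sym n≡))))
                           (trans (per j) (run-x (+-cancelˡ-< q j X.run i<)))
        where
        reassoc : ∀ a b q j → a + (b + (q + j)) ≡ a + (b + q) + j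
        reassoc = solve-∀

      total : Y.run + m + t + m ≡ n
      total = trans (reassoc Y.run X.run m q) (sym n≡)
        where
        reassoc : ∀ t₂ t₁ m q → t₂ + m + (q + t₁) + m ≡ t₁ + m + (t₂ + m + q)
        reassoc = solve-∀

      total″ : t + m + Y.run + m ≡ n
      total″ = trans (reassoc t Y.run m) total
        where
        reassoc : ∀ t p m → t + m + p + m ≡ p + m + t + m
        reassoc = solve-∀

      run-y″ : ∀ {i} → i < Y.run → s″ (t + m + i) ≡ just y
      run-y″ {i} i< = trans (cong s′ (trans (reassoc b t m i) (cong (_+ i) total)))
                        (trans (shift-periodic {s} a per i) (run-y i<))
        where
        reassoc : ∀ b t m i → b + (t + m + i) ≡ b + t + m + i
        reassoc = solve-∀

    no-far : ∀ {h h′} → h + h′ ≡ n → h ≤ h′ → h′ ≤ suc h → m < h → ¬ Far h h′ s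
    -- `facing-runs` expects the shorter run at the origin: `s′` starts with the run of y, `s″` with
    -- the run of x.
    no-far h+h′≡n h≤h′ h′≤1+h m<h far with ≤-total Y.run t
    ... | inj₁ p≤t = x≢y (sym (facing-runs h+h′≡n h≤h′ h′≤1+h m<h {s = s′} Y.run t
                       (shift-far {s} a far) Y.1≤run p≤t total run-y run-x″))
    ... | inj₂ t≤p = x≢y (facing-runs h+h′≡n h≤h′ h′≤1+h m<h {s = s″} t Y.run
                       (shift-far {s′} b (shift-far {s} a far)) (≤-trans X.1≤run (m≤n+m X.run q)) t≤p total″ run-x″ run-y″)

module _ {n m : ℕ} {s : Colouring} (per : Periodic n s) (close : Close m s)
         {x y : Bool} (x≢y : x ≢ y) {l : ℕ} (l<n : l < n) (s0 : s 0 ≡ just x) (sl : s l ≡ just y) where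

  -- The first bound serves connectivity 2m; the strict one, with chords available, serves 2m + 1.
  gaps-bound : (m + m ≤ gaps s n) ×
    (∀ {h h′} → 1 ≤ m → h + h′ ≡ n → h ≤ h′ → h′ ≤ suc h → m < h → Far h h′ s → m + m < gaps s n)
  gaps-bound = from-first (change close x≢y l s0 sl)
    where
    Goal : Set
    Goal = (m + m ≤ gaps s n) ×
      (∀ {h h′} → 1 ≤ m → h + h′ ≡ n → h ≤ h′ → h′ ≤ suc h → m < h → Far h h′ s → m + m < gaps s n)
    from-first : Change m s y l → Goal
    from-first X with m≤n⇒∃[o]m+o≡n (≤-trans (Change.within X) (<⇒≤ l<n))
    -- By periodicity x is back at position n, that is r places after the first change, so a second
    -- change occurs within the same period.
    ... | r , a+r≡n = from-second (change {s = s ↟ a} (shift-close {s} a close) (x≢y ∘ sym) r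
          (trans (cong s (+-identityʳ a)) (Change.arrives X))
          (trans (cong s (trans a+r≡n (sym (+-identityʳ n)))) (trans (per 0) s0)))
      where
      a : ℕ
      a = Change.run X + m
      from-second : Change m (s ↟ a) x r → Goal
      from-second Y with m≤n⇒∃[o]m+o≡n (Change.within Y)
      ... | q , b+q≡r = 2m≤gaps , λ 1≤m h+h′≡n h≤h′ h′≤1+h m<h far →
          ≰⇒> (λ gaps≤2m → no-far 1≤m gaps≤2m h+h′≡n h≤h′ h′≤1+h m<h far)
        where open TwoChanges x≢y per close s0 X r a+r≡n Y q b+q≡r

-- Harary graphs

length-cartesianProductWith : (f : A → B → C) (xs : List A) (ys : List B) →
  length (cartesianProductWith f xs ys) ≡ length xs * length ys
length-cartesianProductWith f []       ys = refl
length-cartesianProductWith f (x ∷ xs) ys = trans (length-++ (map (f x) ys))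
  (cong₂ _+_ (length-map (f x) ys) (length-cartesianProductWith f xs ys))

_∈ᴱ?_ : (e : Fin n × Fin n) (E : List (Fin n × Fin n)) → Dec (e ∈ˡ E)
_∈ᴱ?_ = DecMembership._∈?_ (Product.≡-dec F._≟_ F._≟_)

-- Loops and repetitions in the list are harmless, so the edge lists below are
-- written without regard to them.
fromEdges : List (Fin n × Fin n) → Graph n
fromEdges E = record
  { Adj    = λ u v → u ≢ v × Joined E u v
  ; adj?   = λ u v → ¬? (u F.≟ v) ×-dec (((u , v) ∈ᴱ? E) ⊎-dec ((v , u) ∈ᴱ? E))
  ; sym    = λ (u≢v , uv) → u≢v ∘ sym , Sum.swap uv
  ; irrefl = λ u≡v (u≢v , _) → u≢v u≡v
  }

∑∑𝟙∈≤length : (E : List (Fin n × Fin n)) → sum (λ u → sum (λ v → 𝟙 ((u , v) ∈ᴱ? E))) ≤ length E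
∑∑𝟙∈≤length {n} [] = ≤-reflexive
  (trans (sum-cong-≗ {n} (λ _ → trans (sum-const n) (*-zeroʳ n))) (trans (sum-const n) (*-zeroʳ n)))
∑∑𝟙∈≤length {n} ((a , b) ∷ E) = begin
  sum (λ u → sum (λ v → 𝟙 ((u , v) ∈ᴱ? ((a , b) ∷ E))))
    ≤⟨ sum-mono (λ u → sum-mono (λ v → step u v)) ⟩
  sum (λ u → sum (λ v → first u v + rest u v))
    ≡⟨ trans (sum-cong-≗ (λ u → ∑-distrib-+ (first u) (rest u))) (∑-distrib-+ (sum ∘ first) (sum ∘ rest)) ⟩
  sum (λ u → sum (first u)) + sum (λ u → sum (rest u))
    ≤⟨ +-mono-≤ (≤-reflexive (trans (sum-cong-≗ row) (sum-𝟙≟ a))) (∑∑𝟙∈≤length E) ⟩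
  suc (length E) ∎
  where
  open ≤-Reasoning
  first rest : Fin n → Fin n → ℕ
  first u v = 𝟙 ((u F.≟ a) ×-dec (v F.≟ b))
  rest  u v = 𝟙 ((u , v) ∈ᴱ? E)
  step : ∀ u v → 𝟙 ((u , v) ∈ᴱ? ((a , b) ∷ E)) ≤ first u v + rest u v
  step u v = 𝟙-⊎ (λ { (here refl) → inj₁ (refl , refl) ; (there e) → inj₂ e })
                  ((u , v) ∈ᴱ? ((a , b) ∷ E)) ((u F.≟ a) ×-dec (v F.≟ b)) ((u , v) ∈ᴱ? E)
  row : ∀ u → sum (first u) ≡ 𝟙 (u F.≟ a)
  row u with u F.≟ a
  ... | yes refl = sum-𝟙≟ b
  ... | no u≢a   = trans (sum-const n) (*-zeroʳ n)

-- An inequality is enough: a minimal H is squeezed between the length of such a list and the lower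
-- bound from minimum degree.
size-fromEdges : (E : List (Fin n × Fin n)) → size (fromEdges E) ≤ length E
size-fromEdges {n} E = m+m≤n+n⇒m≤n (begin
  size G + size G
    ≡⟨ degreeSum≡2size G ⟨
  degreeSum G
    ≤⟨ sum-mono (λ u → sum-mono (λ v → orient u v)) ⟩
  sum (λ u → sum (λ v → e u v + e v u))
    ≡⟨ trans (sum-cong-≗ (λ u → ∑-distrib-+ (e u) (λ v → e v u))) (∑-distrib-+ (sum ∘ e) (λ u → sum (λ v → e v u))) ⟩
  sum (λ u → sum (e u)) + sum (λ u → sum (λ v → e v u))
    ≡⟨ cong (sum (λ u → sum (e u)) +_) (∑-comm (λ u v → e v u)) ⟩
  sum (λ u → sum (e u)) + sum (λ u → sum (e u))
    ≤⟨ +-mono-≤ (∑∑𝟙∈≤length E) (∑∑𝟙∈≤length E) ⟩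
  length E + length E ∎)
  where
  open ≤-Reasoning
  G = fromEdges E
  e : Fin n → Fin n → ℕ
  e u v = 𝟙 ((u , v) ∈ᴱ? E)
  orient : ∀ u v → 𝟙 (adj? G u v) ≤ e u v + e v u
  orient u v = 𝟙-⊎ proj₂ (adj? G u v) ((u , v) ∈ᴱ? E) ((v , u) ∈ᴱ? E)

-- Vertices in cyclic order

module _ {n : ℕ} .{{_ : NonZero n}} where

  pos : ℕ → Fin n
  pos i = fromℕ< (m%n<n i n)

  pos-cong : ∀ {i j} → i % n ≡ j % n → pos i ≡ pos j
  pos-cong eq = F.fromℕ<-cong _ _ eq _ _

  pos-toℕ : ∀ x → pos (toℕ x) ≡ x
  pos-toℕ x = trans (F.fromℕ<-cong _ _ (m<n⇒m%n≡m (F.toℕ<n x)) _ (F.toℕ<n x)) (F.fromℕ<-toℕ x _)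

  pos-+n : ∀ i → pos (n + i) ≡ pos i
  pos-+n i = pos-cong (trans (cong (_% n) (+-comm n i)) ([m+n]%n≡m%n i n))

  pos-%+ : ∀ i j → pos (i % n + j) ≡ pos (i + j)
  pos-%+ i j = pos-cong (begin
    (i % n + j) % n              ≡⟨ %-distribˡ-+ (i % n) j n ⟩
    (i % n % n + j % n) % n      ≡⟨ cong (λ z → (z + j % n) % n) (m%n%n≡m%n i n) ⟩
    (i % n + j % n) % n          ≡⟨ %-distribˡ-+ i j n ⟨
    (i + j) % n                  ∎)
    where open ≡-Reasoning

  pos-% : ∀ i → pos (i % n) ≡ pos i
  pos-% i = pos-cong (m%n%n≡m%n i n)

  _≃[_]_ : Fin n → Graph n → Fin n → Set
  u ≃[ G ] v = u ≡ v ⊎ Adj G u v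

  module _ (G : Graph n) (m : ℕ)
           (near : ∀ i j → j ≤ m → pos i ≃[ G ] pos (i + j)) where

    private
      module Cut (S : Subset n) (c : Fin n → Fin n)
                 (c-cong : ∀ {x y} → Within G (∁ S) x y → c x ≡ c y)
                 {u v : Fin n} (u∈ : u ∈ ∁ S) (v∈ : v ∈ ∁ S) (cu≢cv : c u ≢ c v) where

        -- Two colours suffice: the component of u against all the others together, v being among
        -- the latter.
        side : Fin n → Bool
        side w = does (c w F.≟ c u)

        σ : Fin n → Maybe Bool
        σ w with w ∈? S
        ... | yes _ = nothing
        ... | no  _ = just (side w)

        σ-just : ∀ {w} → w ∈ ∁ S → σ w ≡ just (side w)
        σ-just {w} w∈ with w ∈? S
        ... | yes w∈S = contradiction w∈S (x∈∁p⇒x∉p w∈)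
        ... | no _    = refl

        σ-inv : ∀ {w x} → σ w ≡ just x → w ∈ ∁ S × x ≡ side w
        σ-inv {w} eq with w ∈? S
        σ-inv {w} ()   | yes _
        σ-inv {w} refl | no w∉ = x∉p⇒x∈∁p w∉ , refl

        σ-gap : ∀ w → gap (σ w) ≡ 𝟙 (w ∈? S)
        σ-gap w with w ∈? S
        ... | yes _ = refl
        ... | no  _ = refl

        σ-agree : ∀ {w z} → w ≃[ G ] z → ∀ {x y} → σ w ≡ just x → σ z ≡ just y → x ≡ y
        σ-agree (inj₁ refl) eq eq′ = Maybe.just-injective (trans (sym eq) eq′)
        σ-agree (inj₂ wz) eq eq′ with σ-inv eq | σ-inv eq′
        ... | w∈ , refl | z∈ , refl = cong (λ t → does (t F.≟ c u)) (c-cong (w∈ , z∈ , wz))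

        κ₀ κ : Colouring
        κ₀ = σ ∘ pos
        κ  = κ₀ ↟ toℕ u

        κ₀-periodic : Periodic n κ₀
        κ₀-periodic i = cong σ (pos-+n i)

        κ₀-close : Close m κ₀
        κ₀-close i j j≤m = σ-agree (near i j j≤m)

        -- The position of v as seen from u. The truncated subtraction is exact because `toℕ u` is
        -- below n.
        l : ℕ
        l = (toℕ v + (n ∸ toℕ u)) % n

        κ-l : κ l ≡ just false
        κ-l = trans (cong σ u+l) (trans (σ-just v∈) (cong just (dec-false (c v F.≟ c u) (cu≢cv ∘ sym))))
          where
          rotate : toℕ v + (n ∸ toℕ u) + toℕ u ≡ n + toℕ v
          rotate = trans (+-assoc (toℕ v) _ _) (trans (cong (toℕ v +_) (m∸n+n≡m (<⇒≤ (F.toℕ<n u)))) (+-comm (toℕ v) n))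
          u+l : pos (toℕ u + l) ≡ v
          u+l = begin
            pos (toℕ u + l)                            ≡⟨ cong pos (+-comm (toℕ u) l) ⟩
            pos (l + toℕ u)                            ≡⟨ pos-%+ (toℕ v + (n ∸ toℕ u)) (toℕ u) ⟩
            pos (toℕ v + (n ∸ toℕ u) + toℕ u)          ≡⟨ cong pos rotate ⟩
            pos (n + toℕ v)                            ≡⟨ pos-+n (toℕ v) ⟩
            pos (toℕ v)                                ≡⟨ pos-toℕ v ⟩
            v                                          ∎
            where open ≡-Reasoning

        κ-0 : κ 0 ≡ just true
        κ-0 = trans (cong σ (trans (cong pos (+-identityʳ (toℕ u))) (pos-toℕ u)))
                    (trans (σ-just u∈) (cong just (dec-true (c u F.≟ c u) refl)))

        gaps-sum : ∀ (t : Colouring) l → gaps t l ≡ sum {l} (gap ∘ t ∘ toℕ)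
        gaps-sum t zero    = refl
        gaps-sum t (suc l) = cong (gap (t 0) +_) (gaps-sum (t ∘ suc) l)

        gaps≡∣S∣ : gaps κ n ≡ ∣ S ∣
        gaps≡∣S∣ = begin
          gaps κ n                            ≡⟨ gaps-shift {κ₀} (toℕ u) κ₀-periodic ⟩
          gaps κ₀ n                           ≡⟨ gaps-sum κ₀ n ⟩
          sum {n} (gap ∘ σ ∘ pos ∘ toℕ)       ≡⟨ sum-cong-≗ {n} (λ w → trans (cong (gap ∘ σ) (pos-toℕ w)) (σ-gap w)) ⟩
          sum (λ w → 𝟙 (w ∈? S))              ≡⟨ ∣p∣≡sum S ⟨
          ∣ S ∣                               ∎
          where open ≡-Reasoning

        bounds = gaps-bound {n} {m} {κ} (shift-periodic {κ₀} (toℕ u) κ₀-periodic) (shift-close {κ₀} (toℕ u) κ₀-close)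
                   {true} {false} (λ ()) (m%n<n (toℕ v + (n ∸ toℕ u)) n) κ-0 κ-l

        2m≤∣S∣ : m + m ≤ ∣ S ∣
        2m≤∣S∣ = subst (m + m ≤_) gaps≡∣S∣ (proj₁ bounds)

        2m<∣S∣ : ∀ {h h′} → 1 ≤ m → h + h′ ≡ n → h ≤ h′ → h′ ≤ suc h → m < h →
          (∀ i → pos i ≃[ G ] pos (i + h) ⊎ pos i ≃[ G ] pos (i + h′)) → m + m < ∣ S ∣
        2m<∣S∣ {h} {h′} 1≤m h+h′≡n h≤h′ h′≤1+h m<h far = subst (m + m <_) gaps≡∣S∣
          (proj₂ bounds 1≤m h+h′≡n h≤h′ h′≤1+h m<h
            (shift-far {κ₀} {h} {h′} (toℕ u) (λ i → Sum.map (λ r → σ-agree r) (λ r → σ-agree r) (far i))))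

    nonempty-∁ : (S : Subset n) → ∣ S ∣ < n → Nonempty (∁ S)
    nonempty-∁ S S<n with ∃-∉ S S<n
    ... | w , w∉ = w , x∉p⇒x∈∁p w∉

    near⇒kConnected : m + m < n → KConnected (m + m) G
    near⇒kConnected 2m<n = 2m<n , λ S S<2m → connectedOn⁺ G (∁ S) (nonempty-∁ S (<-trans S<2m 2m<n))
      λ c c-cong u v u∈ v∈ → decidable-stable (c u F.≟ c v)
        λ cu≢cv → <⇒≱ S<2m (Cut.2m≤∣S∣ S c c-cong u∈ v∈ cu≢cv)

    far⇒kConnected : ∀ {h h′} → 1 ≤ m → h + h′ ≡ n → h ≤ h′ → h′ ≤ suc h → m < h →
      (∀ i → pos i ≃[ G ] pos (i + h) ⊎ pos i ≃[ G ] pos (i + h′)) →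
      suc (m + m) < n → KConnected (suc (m + m)) G
    far⇒kConnected 1≤m h+h′≡n h≤h′ h′≤1+h m<h far 2m+1<n = 2m+1<n , λ S S≤2m →
      connectedOn⁺ G (∁ S) (nonempty-∁ S (<-trans S≤2m 2m+1<n))
      λ c c-cong u v u∈ v∈ → decidable-stable (c u F.≟ c v)
        λ cu≢cv → <⇒≱ S≤2m (Cut.2m<∣S∣ S c c-cong u∈ v∈ cu≢cv 1≤m h+h′≡n h≤h′ h′≤1+h m<h far)

  shortEdges : ℕ → List (Fin n × Fin n)
  shortEdges m = cartesianProductWith (λ i j → pos i , pos (i + suc j)) (upTo n) (upTo m)

  -- Used with h = ⌊n/2⌋ and h′ = ⌈n/2⌉. The h′ chords meet every vertex; for odd n only vertex h
  -- lies on two of them, which accounts for rounding up the edge count.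
  chords : ℕ → ℕ → List (Fin n × Fin n)
  chords h h′ = map (λ i → pos i , pos (i + h)) (upTo h′)

  length-shortEdges : ∀ m → length (shortEdges m) ≡ n * m
  length-shortEdges m = trans (length-cartesianProductWith _ (upTo n) (upTo m)) (cong₂ _*_ (length-upTo n) (length-upTo m))

  length-chords : ∀ h h′ → length (chords h h′) ≡ h′
  length-chords h h′ = trans (length-map _ (upTo h′)) (length-upTo h′)

  joined⇒≃ : ∀ E {u v} → Joined E u v → u ≃[ fromEdges E ] v
  joined⇒≃ E {u} {v} uv with u F.≟ v
  ... | yes u≡v = inj₁ u≡v
  ... | no u≢v  = inj₂ (u≢v , uv)

  shortEdges-near : ∀ E m → (∀ {e} → e ∈ˡ shortEdges m → e ∈ˡ E) →
    ∀ i j → j ≤ m → pos i ≃[ fromEdges E ] pos (i + j)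
  shortEdges-near E m ⊆E i zero    _   = inj₁ (cong pos (sym (+-identityʳ i)))
  shortEdges-near E m ⊆E i (suc j) j<m = joined⇒≃ E (inj₁ (⊆E
    (subst₂ (λ x y → (x , y) ∈ˡ shortEdges m) (pos-% i) (pos-%+ i (suc j))
      (∈-cartesianProductWith⁺ _ (∈-upTo⁺ (m%n<n i n)) (∈-upTo⁺ j<m)))))

  -- If i % n = h + j, the chord from j ends at i, and i + h′ is j modulo n.
  chords-far : ∀ E {h h′} → h + h′ ≡ n → h ≤ h′ → (∀ {e} → e ∈ˡ chords h h′ → e ∈ˡ E) →
    ∀ i → pos i ≃[ fromEdges E ] pos (i + h) ⊎ pos i ≃[ fromEdges E ] pos (i + h′)
  chords-far E {h} {h′} h+h′≡n h≤h′ ⊆E i with i % n <? h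
  ... | yes i<h = inj₁ (joined⇒≃ E (inj₁ (⊆E
    (subst₂ (λ x y → (x , y) ∈ˡ chords h h′) (pos-% i) (pos-%+ i h)
      (∈-map⁺ _ (∈-upTo⁺ (≤-trans i<h h≤h′)))))))
  ... | no i≮h with m≤n⇒∃[o]m+o≡n (≮⇒≥ i≮h)
  ...   | j , h+j≡ = inj₂ (joined⇒≃ E (inj₂ (⊆E
    (subst₂ (λ x y → (x , y) ∈ˡ chords h h′) target source (∈-map⁺ _ (∈-upTo⁺ j<h′))))))
    where
    j<h′ : j < h′
    j<h′ = +-cancelˡ-< h j h′ (subst₂ _<_ (sym h+j≡) (sym h+h′≡n) (m%n<n i n))
    source : pos (j + h) ≡ pos i
    source = trans (cong pos (trans (+-comm j h) h+j≡)) (pos-% i)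
    rotate : ∀ h h′ j → h + h′ + j ≡ h + j + h′
    rotate = solve-∀
    target : pos j ≡ pos (i + h′)
    target = trans (sym (pos-+n j)) (trans
      (cong pos (trans (cong (_+ j) (sym h+h′≡n)) (trans (rotate h h′ j) (cong (_+ h′) h+j≡))))
      (pos-%+ i h′))

-- ⌈n/2⌉ is ⌊(n + 1)/2⌋. The slack of 1 pays for the surplus half chord when order and connectivity
-- are both odd.
m+m≤1+n⇒m≤⌈n/2⌉ : ∀ m n → m + m ≤ suc n → m ≤ ⌈ n /2⌉
m+m≤1+n⇒m≤⌈n/2⌉ m n le = subst (_≤ ⌈ n /2⌉) (sym (n≡⌊n+n/2⌋ m)) (⌊n/2⌋-mono le)

parity : ∀ d → ∃[ m ] (d ≡ m + m ⊎ d ≡ suc (m + m))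
parity zero = 0 , inj₁ refl
parity (suc d) with parity d
... | m , inj₁ eq = m , inj₂ (cong suc eq)
... | m , inj₂ eq = suc m , inj₁ (cong suc (trans eq (sym (+-suc m m))))

-- For d = 2m the vertices at cyclic distance at most m are joined; for d = 2m + 1 the nearly
-- diametral chords are added. In the application `2 + d ≤ n` comes from α ≥ 2.
harary : ∀ n d → 2 ≤ d → 2 + d ≤ n → Σ[ H ∈ Graph n ] (KConnected d H × size H ≤ ⌈ n * d /2⌉)
harary n@(suc _) d 2≤d 2+d≤n with parity d
... | m , inj₁ refl = fromEdges E , near⇒kConnected (fromEdges E) m (shortEdges-near E m id) (<-trans (n<1+n _) 2+d≤n) ,
  ≤-trans (size-fromEdges E) (subst (_≤ ⌈ n * (m + m) /2⌉) (sym (length-shortEdges m))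
    (m+m≤1+n⇒m≤⌈n/2⌉ (n * m) _ (≤-trans (≤-reflexive (sym (*-distribˡ-+ n m m))) (n≤1+n _))))
  where E = shortEdges {n} m
... | m , inj₂ refl = fromEdges E ,
  far⇒kConnected (fromEdges E) m (shortEdges-near E m ∈-++⁺ˡ) 1≤m h+h′≡n h≤h′ h′≤1+h m<h
    (chords-far E h+h′≡n h≤h′ (∈-++⁺ʳ (shortEdges m))) (<-trans (n<1+n _) 2+d≤n) ,
  ≤-trans (size-fromEdges E) (subst (_≤ ⌈ n * suc (m + m) /2⌉) (sym length≡)
    (m+m≤1+n⇒m≤⌈n/2⌉ (n * m + h′) _ (begin
      n * m + h′ + (n * m + h′)       ≡⟨ rearrange (n * m) h′ ⟩
      n * m + n * m + h′ + h′         ≤⟨ +-monoʳ-≤ (n * m + n * m + h′) h′≤1+h ⟩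
      n * m + n * m + h′ + suc h      ≡⟨ rearrange′ (n * m) h h′ ⟩
      suc (n * m + n * m + (h + h′))  ≡⟨ cong (λ z → suc (n * m + n * m + z)) h+h′≡n ⟩
      suc (n * m + n * m + n)         ≡⟨ cong suc (expand n m) ⟩
      suc (n * suc (m + m))           ∎)))
  where
  open ≤-Reasoning
  h h′ : ℕ
  h  = ⌊ n /2⌋
  h′ = ⌈ n /2⌉
  E : List (Fin n × Fin n)
  E = shortEdges m ++ chords h h′
  length≡ : length E ≡ n * m + h′
  length≡ = trans (length-++ (shortEdges m)) (cong₂ _+_ (length-shortEdges m) (length-chords h h′))
  h+h′≡n : h + h′ ≡ n
  h+h′≡n = ⌊n/2⌋+⌈n/2⌉≡n n
  h≤h′ : h ≤ h′
  h≤h′ = ⌊n/2⌋≤⌈n/2⌉ n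
  h′≤1+h : h′ ≤ suc h
  h′≤1+h = ⌊n/2⌋-mono (n≤1+n (suc n))
  1≤m : 1 ≤ m
  1≤m = n≢0⇒n>0 λ { refl → contradiction 2≤d λ { (s≤s ()) } }
  -- Here 2 + d is 2m + 3, so 2 (m + 1) ≤ n and half of n is at least m + 1.
  m<h : m < h
  m<h = subst (_≤ h) (sym (n≡⌊n+n/2⌋ (suc m)))
    (⌊n/2⌋-mono (≤-trans (≤-trans (≤-reflexive (cong suc (+-suc m m))) (n≤1+n _)) 2+d≤n))
  rearrange : ∀ x y → x + y + (x + y) ≡ x + x + y + y
  rearrange = solve-∀
  rearrange′ : ∀ x h h′ → x + x + h′ + suc h ≡ suc (x + x + (h + h′))
  rearrange′ = solve-∀
  expand : ∀ n m → n * m + n * m + n ≡ n * suc (m + m)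
  expand = solve-∀

-- Extremal graphs

degreeSum-K̄ : ∀ n → degreeSum (K̄ n) ≡ 0
degreeSum-K̄ n = trans (sum-cong-≗ {n} (λ _ → trans (sum-const n) (*-zeroʳ n))) (trans (sum-const n) (*-zeroʳ n))

degreeSum≤0⇒≅K̄ : (H : Graph n) → degreeSum H ≤ 0 → H ≅ K̄ n
degreeSum≤0⇒≅K̄ {n} H le = ↔-id (Fin n) , λ u v → mk⇔ (nonadjacent u v) λ ()
  where
  nonadjacent : ∀ u v → ¬ Adj H u v
  nonadjacent u v uv = n≮0 (<-≤-trans (degreeSum-delete H uv) le)

⌈n*k/2⌉≤size : ∀ {k} (H : Graph n) → KConnected k H → ⌈ n * k /2⌉ ≤ size H
⌈n*k/2⌉≤size {n} {k} H conn = subst (⌈ n * k /2⌉ ≤_) (sym (n≡⌈n+n/2⌉ (size H)))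
  (⌈n/2⌉-mono (≤-trans (n*k≤degreeSum H conn) (≤-reflexive (degreeSum≡2size H))))

Minimal : ℕ → Graph n → Set₁
Minimal {n} d H = (H′ : Graph n) → KConnected d H′ → degreeSum H ≤ degreeSum H′

module _ {α k d : ℕ} (α+d≡k : α + d ≡ k) (2≤α : 2 ≤ α) (3≤k : 3 ≤ k) where

  private
    1≤α : 1 ≤ α
    1≤α = <⇒≤ 2≤α

    2+d≤k : 2 + d ≤ k
    2+d≤k = ≤-trans (+-monoˡ-≤ d 2≤α) (≤-reflexive α+d≡k)

    offset = α * k + k * α

  class⇒join : (G : Graph (α + k)) → InClass α k G →
    Σ[ H ∈ Graph k ] ((G ≅ (K̄ α ∨ H)) × KConnected d H)
  class⇒join G (conn , (S , indep , S≡α) , _) with decompose G conn S indep S≡α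
  ... | H , G≅J = H , G≅J , kConnected-join⁻ α+d≡k 1≤α H (kConnected-≅ G (K̄ α ∨ H) G≅J conn)

  module _ (G : Graph (α + k)) (cls : InClass α k G) (H : Graph k) (G≅J : G ≅ (K̄ α ∨ H)) where

    private
      degreeSum-G : degreeSum G ≡ offset + degreeSum H
      degreeSum-G = trans (degreeSum-≅ G (K̄ α ∨ H) G≅J) (degreeSum-∨ α H)

    extremal⇒minimal : Extremal α k G → Minimal d H
    extremal⇒minimal (_ , _ , least) H′ conn′ = +-cancelˡ-≤ offset _ _ (begin
      offset + degreeSum H         ≡⟨ degreeSum-G ⟨
      degreeSum G                  ≤⟨ size-mono⇒degreeSum-mono G (K̄ α ∨ H′)
                                        (least _ (K̄ α ∨ H′ , inClass-join α+d≡k 1≤α H′ conn′ , refl)) ⟩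
      degreeSum (K̄ α ∨ H′)         ≡⟨ degreeSum-∨ α H′ ⟩
      offset + degreeSum H′        ∎)
      where open ≤-Reasoning

    -- Every competitor is itself a join by `class⇒join`, with the same `offset`, so the comparison
    -- descends to H and a d-connected H′.
    minimal⇒extremal : Minimal d H → Extremal α k G
    minimal⇒extremal minimal = cls , (G , cls , refl) , λ { _ (G′ , cls′ , refl) → bound G′ (class⇒join G′ cls′) }
      where
      open ≤-Reasoning
      bound : (G′ : Graph (α + k)) → Σ[ H′ ∈ Graph k ] ((G′ ≅ (K̄ α ∨ H′)) × KConnected d H′) → size G ≤ size G′
      bound G′ (H′ , G′≅J′ , conn′) = degreeSum-mono⇒size-mono G G′ (begin
        degreeSum G              ≡⟨ degreeSum-G ⟩
        offset + degreeSum H     ≤⟨ +-monoʳ-≤ offset (minimal H′ conn′) ⟩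
        offset + degreeSum H′    ≡⟨ trans (degreeSum-≅ G′ (K̄ α ∨ H′) G′≅J′) (degreeSum-∨ α H′) ⟨
        degreeSum G′             ∎)

  Shape : Graph k → Set
  Shape H = (d ≡ 0 → H ≅ K̄ k) × (d ≡ 1 → Tree H) × (2 ≤ d → KConnected d H × (size H ≡ ⌈ k * d /2⌉))

  minimal⇒shape : (H : Graph k) → KConnected d H → Minimal d H → Shape H
  minimal⇒shape H conn minimal = empty , tree , sparse
    where
    empty : d ≡ 0 → H ≅ K̄ k
    -- K̄ k is 0-connected vacuously, since no set has fewer than 0 elements; comparison with it
    -- forces degree sum 0.
    empty refl = degreeSum≤0⇒≅K̄ H (≤-trans (minimal (K̄ k) (<-≤-trans (s≤s z≤n) 3≤k , λ _ ()))
                                           (≤-reflexive (degreeSum-K̄ k)))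
    tree : d ≡ 1 → Tree H
    tree refl = connH , minimal-connected⇒acyclic H connH
      (λ H′ connH′ → minimal H′ (connected⇒kConnected₁ H′ (<-≤-trans (s≤s (s≤s z≤n)) 3≤k) connH′))
      where connH = kConnected₁⇒connected H conn
    sparse : 2 ≤ d → KConnected d H × (size H ≡ ⌈ k * d /2⌉)
    sparse 2≤d with harary k d 2≤d 2+d≤k
    ... | H′ , conn′ , size′ = conn , ≤-antisym
      (≤-trans (degreeSum-mono⇒size-mono H H′ (minimal H′ conn′)) size′) (⌈n*k/2⌉≤size H conn)

  shape⇒minimal : (H : Graph k) → Shape H → Minimal d H
  shape⇒minimal H (empty , tree , sparse) H′ conn′ = by-cases d refl
    where
    by-cases : ∀ e → d ≡ e → degreeSum H ≤ degreeSum H′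
    by-cases zero d≡0 = ≤-trans (≤-reflexive (trans (degreeSum-≅ H (K̄ k) (empty d≡0)) (degreeSum-K̄ k))) z≤n
    by-cases (suc zero) refl with tree refl
    -- The tree attains k = 1 + size, while any connected H′ has k ≤ 1 + size.
    ... | connH , acyclic = size-mono⇒degreeSum-mono H H′ (s≤s⁻¹ (subst (_≤ suc (size H′))
      (tree⇒n≡1+size H connH acyclic) (connected⇒n≤1+size H′ (kConnected₁⇒connected H′ conn′))))
    by-cases (suc (suc e)) refl with sparse (s≤s (s≤s z≤n))
    ... | _ , size≡ = size-mono⇒degreeSum-mono H H′ (≤-trans (≤-reflexive size≡) (⌈n*k/2⌉≤size H′ conn′))

corollary3p2 : ∀ (α k : ℕ) → 2 ≤ α → 3 ≤ k → α ≤ k →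
    let d = k ∸ α in
    (G : Graph (α + k)) → KConnected k G → IndependenceNumber G α →
    Extremal α k G ⇔
    (Σ[ H ∈ Graph k ]
    ((G ≅ (K̄ α ∨ H)) ×
    (d ≡ 0 → H ≅ K̄ k) ×
    (d ≡ 1 → Tree H) ×
    (2 ≤ d → KConnected d H × (size H ≡ ⌈ k * d /2⌉))))
corollary3p2 α k 2≤α 3≤k α≤k G conn indep = mk⇔
  (λ extremal → let H , G≅J , connH = class⇒join α+d≡k 2≤α 3≤k G cls in
    H , G≅J , minimal⇒shape α+d≡k 2≤α 3≤k H connH (extremal⇒minimal α+d≡k 2≤α 3≤k G cls H G≅J extremal))
  (λ (H , G≅J , shape) → minimal⇒extremal α+d≡k 2≤α 3≤k G cls H G≅J (shape⇒minimal α+d≡k 2≤α 3≤k H shape))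
  where
  cls : InClass α k G
  cls = conn , indep
  α+d≡k : α + (k ∸ α) ≡ k
  α+d≡k = m+[n∸m]≡n α≤k
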